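{- (a) $L_D^-(2)\geq\frac{3}{8}$, so $R_D^-(2)>1.22474$. (b) $L_D^-(3)\geq\frac{9}{125}$, so $R_D^-(3)>1.24805$. (c) $L_D^-(4)\geq\frac{13}{1296}$, so $R_D^-(4)>1.26588$. (d) $L_D^-(5)\geq\frac{17}{16807}$, so $R_D^-(5)>1.25881$. (e) $L_D^-(6)\geq\frac{3}{32768}$, so $R_D^-(6)>1.27378$. (f) $L_D^-(7)\geq\frac{10}{1594323}$, so $R_D^-(7)>1.26436$. (g) $L_D^-(8)\geq\frac{9}{25000000}$, so $R_D^-(8)>1.25206$. (h) $L_D^-(9)\geq\frac{42}{2357947691}$, so $R_D^-(9)>1.23939$.
   Context: A directed circulant graph is a Cayley graph $\mathrm{Cay}(\mathbb{Z}_n,S)$ of a cyclic group ($0\notin S$, arc from $g$ to $g+s$ for $s\in S$), of degree $|S|$. $DCC(d,k)$ denotes the largest order of a directed circulant graph with degree $d$ and diameter $k$. Define $L^-_D(k)=\liminf_{d\to\infty}DCC(d,k)/d^k$ and $R^-_D(k)=k\,L^-_D(k)^{1/k}$. -}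

module Defs where

open import Data.Nat as ℕ using (ℕ; zero; suc; NonZero)
open import Data.Nat.DivMod using (_mod_)
open import Data.Fin using (Fin; toℕ)
open import Data.Fin.Subset using (Subset; _∈_; _∉_; ∣_∣)
open import Data.Integer using (+_)
open import Data.Rational using (ℚ; _/_; _+_; _-_; _*_; _≤_; _<_; 0ℚ; 1ℚ)
open import Data.Product using (Σ; ∃; _×_)
open import Relation.Binary.PropositionalEquality using (_≡_)
open import Relation.Nullary using (¬_)

-- Vertices of Cay(ℤ_n, S) are Fin n (n ≥ 1), with addition mod n.
addMod : {n : ℕ} {{_ : NonZero n}} → Fin n → Fin n → Fin n
addMod {n} u s = (toℕ u ℕ.+ toℕ s) mod n

data Walk {n : ℕ} {{_ : NonZero n}} (S : Subset n) : ℕ → Fin n → Fin n → Set where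
  here : ∀ {u} → Walk S zero u u
  step : ∀ {j u v} (s : Fin n) → s ∈ S → Walk S j (addMod u s) v → Walk S (suc j) u v

IsConnSet : (n : ℕ) {{_ : NonZero n}} → Subset n → ℕ → Set
IsConnSet n S d = ((0 mod n) ∉ S) × (∣ S ∣ ≡ d)

HasDiameter : (n : ℕ) {{_ : NonZero n}} → Subset n → ℕ → Set
HasDiameter n S k =
  ((u v : Fin n) → ∃ λ j → (j ℕ.≤ k) × Walk S j u v) ×
  Σ (Fin n) (λ u → Σ (Fin n) (λ v → (j : ℕ) → j ℕ.< k → ¬ Walk S j u v))

DCirc : ℕ → ℕ → ℕ → Set
DCirc n d k = Σ (NonZero n) λ nz →
  Σ (Subset n) λ S → IsConnSet n {{nz}} S d × HasDiameter n {{nz}} S k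

IsDCC : ℕ → ℕ → ℕ → Set
IsDCC d k m = DCirc m d k × ((n : ℕ) → DCirc n d k → n ℕ.≤ m)

fromℕ : ℕ → ℚ
fromℕ m = + m / 1

powℚ : ℚ → ℕ → ℚ
powℚ q zero = 1ℚ
powℚ q (suc j) = q * powℚ q j

-- L⁻_D(k) ≥ c, i.e. liminf_{d→∞} DCC(d,k)/d^k ≥ c:
-- for every ε > 0, eventually DCC(d,k) ≥ (c - ε)·d^k.
LiminfGE : ℕ → ℚ → Set
LiminfGE k c = (ε : ℚ) → 0ℚ < ε → ∃ λ D → (d : ℕ) → D ℕ.≤ d →
  (m : ℕ) → IsDCC d k m → (c - ε) * fromℕ (d ℕ.^ k) ≤ fromℕ m

-- R⁻_D(k) = k·L⁻_D(k)^{1/k} > r  ⇔  L⁻_D(k) > (r/k)^k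
--   ⇔ ∃ δ > 0 with L⁻_D(k) ≥ (r/k)^k + δ.
RGreater : (k : ℕ) {{_ : NonZero k}} → ℚ → Set
RGreater k r = ∃ λ δ → 0ℚ < δ × LiminfGE k (powℚ (r * (+ 1 / k)) k + δ)

Part : (k : ℕ) {{_ : NonZero k}} → ℚ → ℚ → Set
Part k c r = LiminfGE k c × RGreater k r

{-# OPTIONS --safe #-}
module Submission where

-- Let ℓ = k + 2 and let β₀, …, β_{ℓ-1} be such that the sums of k of them cover ℤ_w.  The circulant graphs have
-- order w q^k, where q ≡ 1 (mod M) with M = (k+1)!, and generators βⱼ + x w Dⱼ for 0 ≤ x < q + O(1),
-- where D₀, …, D_{ℓ-1} are directions any k of which span ℤ / q^k with coefficients in [0, q + O(1)).  As
-- the degree is ℓ q + O(1), this gives the density w / ℓ^k.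
--
-- To get such directions, take v_l = q^l M^(k-1-l) for l < k, so that q v_l = M v_{l+1} and q v_{k-1} = 0, and
-- add two directions so that Σ Dⱼ = Σ j Dⱼ = 0.  The differences of indices are units modulo q and divide
-- M, so that M times each direction, hence also q times each direction, is a combination with bounded
-- coefficients of any k of the directions.  An arbitrary element is M Σ e_l v_l with digits e_l < q; its
-- coefficients in the chosen k directions are O(q), and reducing them modulo q costs only O(1).
--
-- Further generators bring the degree to the exact value d, and the diameter is not below k since there
-- are only O(d^(k-1)) walks of length less than k.

open import Defs
open import Data.Nat as ℕ using (ℕ; zero; suc; NonZero; _!)
import Data.Nat.Properties as ℕ
import Data.Nat.DivMod as ℕ
import Data.Nat.Divisibility as ℕ
import Data.Nat.Tactic.RingSolver as ℕ
open import Data.Integer using (+_)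
open import Data.Integer as ℤ using (ℤ; -[1+_]; +[1+_]; 0ℤ; 1ℤ; -_; _+_; _-_; _*_; _^_; ∣_∣)
import Data.Integer.Properties as ℤ
import Data.Integer.Divisibility.Signed as ℤ
open import Data.Integer.DivMod using (_/ℕ_; _%ℕ_; n%ℕd<d; a≡a%ℕn+[a/ℕn]*n)
open import Data.Integer.Tactic.RingSolver using (solve-∀)
open import Data.Rational as ℚ using (ℚ; mkℚ; 0ℚ; toℚᵘ; ↥_; ↧_)
open import Data.Rational using (_/_)
import Data.Rational.Properties as ℚ
open import Data.Rational.Unnormalised as ℚᵘ using (mkℚᵘ; *≤*)
import Data.Rational.Unnormalised.Properties as ℚᵘ
import Algebra.Properties.Semiring.Sum ℤ.+-*-semiring as Sum
open import Algebra.Properties.Semiring.Sum ℕ.+-*-semiring using (sum)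
open import Data.Fin using (Fin; zero; suc; toℕ; fromℕ<; punchIn; punchOut)
import Data.Fin.Properties as Fin
open import Data.Fin.Subset using (Subset; inside; outside; _∈_; _⊆_; ⁅_⁆; _∪_; _∩_; ∁; ⊥) renaming (∣_∣ to ∣_∣ˢ)
import Data.Fin.Subset.Properties as Sub
open import Data.Vec using (Vec; []; _∷_; here; there; lookup)
open import Data.List as List using (List; []; _∷_; length; _++_; concatMap; map; upTo; allFin)
import Data.List.Properties as List
import Data.List.Relation.Unary.Any as Any
open import Data.List.Membership.Propositional using () renaming (_∈_ to _∈ˡ_)
open import Data.List.Membership.Propositional.Properties
  using (∈-map⁺; ∈-concatMap⁺; ∈-++⁺ˡ; ∈-++⁺ʳ; ∈-allFin; ∈-upTo⁺)
open import Data.List.Membership.Setoid.Properties using (index-injective)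
import Data.List.Membership.DecPropositional as DecMembership
open import Data.Product using (_×_)
open import Data.Product using (Σ; ∃; ∃₂; _,_; proj₁; proj₂)
open import Data.Sum using (_⊎_; inj₁; inj₂)
open import Function using (_∘_)
open import Relation.Nullary using (¬_; yes; no)
open import Relation.Nullary.Decidable using (Dec; True; toWitness)
open import Relation.Binary.PropositionalEquality

-- Finite sums of integers.

abstract

  -- Abstract, so that a sum is an opaque term that unfolds only through the equations of this
  -- block.
  ∑ : ∀ {n} → (Fin n → ℤ) → ℤ
  ∑ = Sum.sum

  ∑-empty : (f : Fin 0 → ℤ) → ∑ f ≡ 0ℤ
  ∑-empty f = refl

  ∑-suc : ∀ {n} (f : Fin (suc n) → ℤ) → ∑ f ≡ f zero + ∑ (f ∘ suc)
  ∑-suc f = refl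

  ∑-cong : ∀ {n} {f g : Fin n → ℤ} → (∀ i → f i ≡ g i) → ∑ f ≡ ∑ g
  ∑-cong {f = f} {g} f≡g = Sum.sum-cong-≋ {x = f} {y = g} f≡g

  ∑-zero : ∀ n → ∑ {n} (λ _ → 0ℤ) ≡ 0ℤ
  ∑-zero = Sum.sum-replicate-zero

  ∑-+ : ∀ {n} (f g : Fin n → ℤ) → ∑ (λ i → f i + g i) ≡ ∑ f + ∑ g
  ∑-+ = Sum.∑-distrib-+

  ∑-*ˡ : ∀ {n} a (f : Fin n → ℤ) → a * ∑ f ≡ ∑ (λ i → a * f i)
  ∑-*ˡ = Sum.*-distribˡ-sum

  ∑-remove : ∀ {n} (f : Fin (suc n) → ℤ) i → ∑ f ≡ f i + ∑ (f ∘ punchIn i)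
  ∑-remove f i = Sum.sum-remove {i = i} f

∑-indicator : ∀ {m} (f : Fin m → ℤ) i →
  Σ (Fin m → ℤ) λ c → (∀ j → ∣ c j ∣ ℕ.≤ 1) × f i ≡ ∑ (λ j → c j * f j)
∑-indicator {suc m} f zero = c , c≤ , sym (trans (∑-suc _) (begin
    1ℤ * f zero + ∑ (λ j → 0ℤ * f (suc j)) ≡⟨ cong₂ _+_ (ℤ.*-identityˡ (f zero))
      (trans (∑-cong (λ j → ℤ.*-zeroˡ (f (suc j)))) (∑-zero m)) ⟩
    f zero + 0ℤ                            ≡⟨ ℤ.+-identityʳ (f zero) ⟩
    f zero                                 ∎))
  where
  open ≡-Reasoning
  c : Fin (suc m) → ℤ
  c zero    = 1ℤ
  c (suc _) = 0ℤ
  c≤ : ∀ j → ∣ c j ∣ ℕ.≤ 1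
  c≤ zero    = ℕ.≤-refl
  c≤ (suc _) = ℕ.z≤n
∑-indicator {suc m} f (suc i) with ∑-indicator (f ∘ suc) i
... | c , c≤ , eq = c′ , c′≤ , trans eq (sym (trans (∑-suc _) (trans
    (cong (_+ ∑ (λ j → c j * f (suc j))) (ℤ.*-zeroˡ (f zero))) (ℤ.+-identityˡ _))))
  where
  c′ : Fin (suc m) → ℤ
  c′ zero    = 0ℤ
  c′ (suc j) = c j
  c′≤ : ∀ j → ∣ c′ j ∣ ℕ.≤ 1
  c′≤ zero    = ℕ.z≤n
  c′≤ (suc j) = c≤ j

-- Combinations with bounded coefficients modulo `N`.

module SmallCombinations (N : ℤ) {n : ℕ} (u : Fin n → ℤ) where

  -- Membership in the span modulo `N` with a record of the coefficient size: the argument turns on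
  -- which bounds are constants and which grow linearly in q.
  Small : ℕ → ℤ → Set
  Small C y = Σ (Fin n → ℤ) λ c →
    (∀ i → ∣ c i ∣ ℕ.≤ C) × ∃ λ s → y ≡ ∑ (λ i → c i * u i) + s * N

  small-weaken : ∀ {C C′ y} → C ℕ.≤ C′ → Small C y → Small C′ y
  small-weaken C≤C′ (c , c≤ , p) = c , (λ i → ℕ.≤-trans (c≤ i) C≤C′) , p

  small-multiple : ∀ s → Small 0 (s * N)
  small-multiple s = (λ _ → 0ℤ) , (λ _ → ℕ.z≤n) , s , sym (trans
    (cong (_+ s * N) (trans (∑-cong (λ i → ℤ.*-zeroˡ (u i))) (∑-zero n)))
    (ℤ.+-identityˡ (s * N)))

  small-+ : ∀ {C C′ y y′} → Small C y → Small C′ y′ → Small (C ℕ.+ C′) (y + y′)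
  small-+ (c , c≤ , s , refl) (c′ , c′≤ , s′ , refl) =
    (λ i → c i + c′ i) ,
    (λ i → ℕ.≤-trans (ℤ.∣i+j∣≤∣i∣+∣j∣ (c i) (c′ i)) (ℕ.+-mono-≤ (c≤ i) (c′≤ i))) ,
    s + s′ ,
    trans (regroup (∑ (λ i → c i * u i)) (∑ (λ i → c′ i * u i)) s s′ N)
      (cong (_+ (s + s′) * N) (sym (trans
        (∑-cong (λ i → ℤ.*-distribʳ-+ (u i) (c i) (c′ i)))
        (∑-+ (λ i → c i * u i) (λ i → c′ i * u i)))))
    where
    regroup : ∀ a b s s′ N → a + s * N + (b + s′ * N) ≡ a + b + (s + s′) * N
    regroup = solve-∀

  small-* : ∀ {A C y} a → ∣ a ∣ ℕ.≤ A → Small C y → Small (A ℕ.* C) (a * y)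
  small-* a a≤ (c , c≤ , s , refl) =
    (λ i → a * c i) ,
    (λ i → subst (ℕ._≤ _) (sym (ℤ.abs-* a (c i))) (ℕ.*-mono-≤ a≤ (c≤ i))) ,
    a * s ,
    trans (expand a (∑ (λ i → c i * u i)) s N)
      (cong (_+ a * s * N) (trans
        (∑-*ˡ a (λ i → c i * u i))
        (∑-cong (λ i → sym (ℤ.*-assoc a (c i) (u i))))))
    where
    expand : ∀ a b s N → a * (b + s * N) ≡ a * b + a * s * N
    expand = solve-∀

  small-sum : ∀ {m A C} (a y : Fin m → ℤ) → (∀ l → ∣ a l ∣ ℕ.≤ A) → (∀ l → Small C (y l)) →
    Small (m ℕ.* (A ℕ.* C)) (∑ (λ l → a l * y l))
  small-sum {zero}  a y a≤ sm = subst (Small 0) (sym (∑-empty _)) (small-multiple 0ℤ)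
  small-sum {suc m} a y a≤ sm = subst (Small _) (sym (∑-suc _))
    (small-+ (small-* (a zero) (a≤ zero) (sm zero))
             (small-sum (a ∘ suc) (y ∘ suc) (a≤ ∘ suc) (sm ∘ suc)))

  small-generator : ∀ i → Small 1 (u i)
  small-generator i with ∑-indicator u i
  ... | c , c≤ , eq = c , c≤ , 0ℤ , trans eq (sym (ℤ.+-identityʳ _))

-- The quotient times `q` is `z` minus its remainder; the remainder, below `q`, costs the extra 1 in
-- `suc K`.
∣z/q∣≤ : ∀ z q K .{{_ : NonZero q}} → ∣ z ∣ ℕ.≤ K ℕ.* q → ∣ z /ℕ q ∣ ℕ.≤ suc K
∣z/q∣≤ z q K z≤ = ℕ.*-cancelʳ-≤ ∣ z /ℕ q ∣ (suc K) q (begin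
    ∣ z /ℕ q ∣ ℕ.* q             ≡⟨ ℤ.abs-* (z /ℕ q) (+ q) ⟨
    ∣ (z /ℕ q) * + q ∣           ≡⟨ cong ∣_∣ (isolate (+ (z %ℕ q)) ((z /ℕ q) * + q)) ⟩
    ∣ (+ (z %ℕ q) + (z /ℕ q) * + q) - + (z %ℕ q) ∣ ≡⟨ cong (λ x → ∣ x - + (z %ℕ q) ∣) (a≡a%ℕn+[a/ℕn]*n z q) ⟨
    ∣ z - + (z %ℕ q) ∣           ≤⟨ ℤ.∣i-j∣≤∣i∣+∣j∣ z (+ (z %ℕ q)) ⟩
    ∣ z ∣ ℕ.+ z %ℕ q             ≤⟨ ℕ.+-mono-≤ z≤ (ℕ.<⇒≤ (n%ℕd<d z q)) ⟩
    K ℕ.* q ℕ.+ q                ≡⟨ ℕ.+-comm (K ℕ.* q) q ⟩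
    suc K ℕ.* q                  ∎)
  where
  open ℕ.≤-Reasoning
  isolate : ∀ r x → x ≡ (r + x) - r
  isolate = solve-∀

shift-nonneg : ∀ c C → ∣ c ∣ ℕ.≤ C → ∃ λ a → (a ℕ.≤ C ℕ.+ C) × c + + C ≡ + a
shift-nonneg (+ c)    C c≤C = c ℕ.+ C , ℕ.+-monoˡ-≤ C c≤C , refl
shift-nonneg -[1+ c ] C c≤C = C ℕ.∸ suc c , ℕ.≤-trans (ℕ.m∸n≤m C (suc c)) (ℕ.m≤m+n C C) , ℤ.⊖-≥ c≤C

-- If the elements q uᵢ have small coordinates then the coordinates of an element can be reduced
-- modulo q, so that coordinates from an interval barely longer than q suffice.
module Reduction (q : ℕ) .{{_ : NonZero q}} (N : ℤ) {n : ℕ} (u : Fin n → ℤ) where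
  open SmallCombinations N u

  -- Each coefficient is split into remainder and quotient by `q`. The quotients are at most
  -- `suc K`, and they multiply elements `q uᵢ` with coordinates at most `C`, so the bound on the
  -- correction `y′` does not involve `q`.
  reduce : ∀ {K C y} → Small (K ℕ.* q) y → (∀ i → Small C (+ q * u i)) →
    Σ (Fin n → ℕ) λ r → (∀ i → r i ℕ.< q) ×
    ∃ λ y′ → Small (n ℕ.* (suc K ℕ.* C)) y′ × y ≡ ∑ (λ i → + r i * u i) + y′
  reduce {K} {C} (z , z≤ , s , refl) sm =
    (λ i → z i %ℕ q) , (λ i → n%ℕd<d (z i) q) ,
    quotients + s * N ,
    subst (λ b → Small b (quotients + s * N)) (ℕ.+-identityʳ _)
      (small-+ (small-sum (λ i → z i /ℕ q) (λ i → + q * u i) (λ i → ∣z/q∣≤ (z i) q K (z≤ i)) sm)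
               (small-multiple s)) ,
    trans (cong (_+ s * N) (trans (∑-cong split)
        (∑-+ (λ i → + (z i %ℕ q) * u i) (λ i → (z i /ℕ q) * (+ q * u i)))))
      (ℤ.+-assoc (∑ (λ i → + (z i %ℕ q) * u i)) quotients (s * N))
    where
    quotients = ∑ (λ i → (z i /ℕ q) * (+ q * u i))
    distrib : ∀ r x q u → (r + x * q) * u ≡ r * u + x * (q * u)
    distrib = solve-∀
    split : ∀ i → z i * u i ≡ + (z i %ℕ q) * u i + (z i /ℕ q) * (+ q * u i)
    split i = trans (cong (_* u i) (a≡a%ℕn+[a/ℕn]*n (z i) q)) (distrib (+ (z i %ℕ q)) (z i /ℕ q) (+ q) (u i))

  -- The correction left by `reduce` may have negative coefficients. Reducing `y - B Σ uᵢ` instead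
  -- and adding `B` back to every coefficient moves the correction from [-B, B] to [0, 2B].
  cover : ∀ {K C} → (∀ y → Small (K ℕ.* q) y) → (∀ i → Small C (+ q * u i)) → ∀ y →
    let B = n ℕ.* (suc K ℕ.* C) in
    Σ (Fin n → ℕ) λ x → (∀ i → x i ℕ.< q ℕ.+ (B ℕ.+ B)) × ∃ λ s → y ≡ ∑ (λ i → + x i * u i) + s * N
  cover {K} {C} all sm y
    with r , r< , y′ , (c , c≤ , s , refl) , eq
      ← reduce {K} {C} (all (y - ∑ (λ i → + (n ℕ.* (suc K ℕ.* C)) * u i))) sm =
    (λ i → r i ℕ.+ proj₁ (shifted c c≤ i)) ,
    (λ i → ℕ.+-mono-<-≤ (r< i) (proj₁ (proj₂ (shifted c c≤ i)))) , s , (begin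
      y                     ≡⟨ unshift y b ⟩
      (y - b) + b           ≡⟨ cong (_+ b) eq ⟩
      ∑ (λ i → + r i * u i) + (∑ (λ i → c i * u i) + s * N) + b
        ≡⟨ regroup (∑ (λ i → + r i * u i)) (∑ (λ i → c i * u i)) (s * N) b ⟩
      ∑ (λ i → + r i * u i) + (∑ (λ i → c i * u i) + b) + s * N
        ≡⟨ cong (λ e → ∑ (λ i → + r i * u i) + e + s * N) (∑-+ (λ i → c i * u i) (λ i → + B * u i)) ⟨
      ∑ (λ i → + r i * u i) + ∑ (λ i → c i * u i + + B * u i) + s * N
        ≡⟨ cong (_+ s * N) (∑-+ (λ i → + r i * u i) (λ i → c i * u i + + B * u i)) ⟨
      ∑ (λ i → + r i * u i + (c i * u i + + B * u i)) + s * N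
        ≡⟨ cong (_+ s * N) (∑-cong (λ i → trans (factor (+ r i) (c i) (+ B) (u i))
             (cong (λ e → (+ r i + e) * u i) (proj₂ (proj₂ (shifted c c≤ i)))))) ⟩
      ∑ (λ i → + (r i ℕ.+ proj₁ (shifted c c≤ i)) * u i) + s * N  ∎)
    where
    open ≡-Reasoning
    B = n ℕ.* (suc K ℕ.* C)
    b = ∑ (λ i → + B * u i)
    shifted : ∀ (c : Fin n → ℤ) → (∀ i → ∣ c i ∣ ℕ.≤ B) → ∀ i → ∃ λ a → (a ℕ.≤ B ℕ.+ B) × c i + + B ≡ + a
    shifted c c≤ i = shift-nonneg (c i) B (c≤ i)
    unshift : ∀ y b → y ≡ (y - b) + b
    unshift = solve-∀
    regroup : ∀ r c s b → r + (c + s) + b ≡ r + (c + b) + s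
    regroup = solve-∀
    factor : ∀ r c b u → r * u + (c * u + b * u) ≡ (r + (c + b)) * u
    factor = solve-∀

-- Directions modulo q^k

*-left-comm : ∀ a b c → a * (b * c) ≡ b * (a * c)
*-left-comm = solve-∀

-- powers q M k l = q^l M^(k-1-l).
powers : ℤ → ℤ → (k : ℕ) → Fin k → ℤ
powers q M (suc k) zero    = M ^ k
powers q M (suc k) (suc l) = q * powers q M k l

-- In the first case `l′` is the successor of `l`; it is existential because the last index has
-- none, and there the product is the modulus itself.
powers-step : ∀ q M k l →
  (∃ λ l′ → q * powers q M k l ≡ M * powers q M k l′) ⊎ q * powers q M k l ≡ q ^ k
powers-step q M (suc zero)    zero    = inj₂ refl
powers-step q M (suc (suc k)) zero    = inj₁ (suc zero , *-left-comm q M (M ^ k))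
powers-step q M (suc k)       (suc l) with powers-step q M k l
... | inj₁ (l′ , eq) = inj₁ (suc l′ , trans (cong (q *_) eq) (*-left-comm q M (powers q M k l′)))
... | inj₂ eq        = inj₂ (cong (q *_) eq)

module Digits (M t : ℕ) where

  q : ℕ
  q = suc (M ℕ.* t)

  +q : + q ≡ 1ℤ + + M * + t
  +q = trans (ℤ.pos-+ 1 (M ℕ.* t)) (cong (λ x → 1ℤ + x) (ℤ.pos-* M t))

  -- As `q = 1 + M t`, the number `- t` inverts `M` modulo `q`; its powers invert the powers of `M`.
  inverse : ∀ k → ∃₂ λ a b → a * (+ M) ^ k ≡ 1ℤ + b * + q
  inverse zero = 1ℤ , 0ℤ , refl
  inverse (suc k) with inverse k
  ... | a , b , eq = - + t * a , b - 1ℤ - b * + q , (begin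
      - + t * a * (+ M * (+ M) ^ k)          ≡⟨ regroup (+ t) a (+ M) ((+ M) ^ k) ⟩
      a * (+ M) ^ k * (1ℤ - (1ℤ + + M * + t)) ≡⟨ cong₂ (λ x y → x * (1ℤ - y)) eq (sym +q) ⟩
      (1ℤ + b * + q) * (1ℤ - + q)          ≡⟨ expand b (+ q) ⟩
      1ℤ + (b - 1ℤ - b * + q) * + q        ∎)
    where
    open ≡-Reasoning
    regroup : ∀ t a M p → - t * a * (M * p) ≡ a * p * (1ℤ - (1ℤ + M * t))
    regroup = solve-∀
    expand : ∀ b q → (1ℤ + b * q) * (1ℤ - q) ≡ 1ℤ + (b - 1ℤ - b * q) * q
    expand = solve-∀

  -- Hensel lifting: if `a` inverts `M` modulo `q^k` with error `b q^k`, then subtracting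
  -- `a₁ b q^k`, where `a₁` inverts `M` modulo `q`, leaves an error divisible by `q^(k+1)`.
  inverse-power : ∀ k → ∃₂ λ a b → a * + M ≡ 1ℤ + b * (+ q) ^ k
  inverse-power zero = 0ℤ , - 1ℤ , refl
  inverse-power (suc k) with inverse-power k | inverse 1
  ... | a , b , eq | a₁ , b₁ , eq₁ = a - a₁ * b * (+ q) ^ k , - b * b₁ , (begin
      (a - a₁ * b * (+ q) ^ k) * + M                      ≡⟨ regroup a a₁ b ((+ q) ^ k) (+ M) ⟩
      a * + M - a₁ * (+ M * 1ℤ) * (b * (+ q) ^ k)        ≡⟨ cong₂ (λ x y → x - y * (b * (+ q) ^ k)) eq eq₁ ⟩
      (1ℤ + b * (+ q) ^ k) - (1ℤ + b₁ * + q) * (b * (+ q) ^ k) ≡⟨ expand b b₁ (+ q) ((+ q) ^ k) ⟩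
      1ℤ + - b * b₁ * (+ q * (+ q) ^ k)                  ∎)
    where
    open ≡-Reasoning
    regroup : ∀ a a₁ b p M → (a - a₁ * b * p) * M ≡ a * M - a₁ * (M * 1ℤ) * (b * p)
    regroup = solve-∀
    expand : ∀ b b₁ q p → (1ℤ + b * p) - (1ℤ + b₁ * q) * (b * p) ≡ 1ℤ + - b * b₁ * (q * p)
    expand = solve-∀

  -- An expansion in base `q` with modified place values. All place values but the first, `M^k`, are
  -- divisible by `q`, and `M^k` is a unit modulo `q`; so the first digit is determined modulo `q`
  -- and the rest follows by recursion.
  digits : ∀ k y → Σ (Fin k → ℤ) λ e → (∀ l → ∣ e l ∣ ℕ.≤ q) ×
    ∃ λ s → y ≡ ∑ (λ l → e l * powers (+ q) (+ M) k l) + s * (+ q) ^ k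
  digits zero y = (λ ()) , (λ ()) , y , sym (trans (cong₂ _+_ (∑-empty _) (ℤ.*-identityʳ y)) (ℤ.+-identityˡ y))
  digits (suc k) y with inverse k
  -- With `r` the remainder of `y a` modulo `q`, this argument is exactly `(y - r M^k) / q`.
  ... | a , b , eq with digits k (z * (+ M) ^ k - y * b)
    where z = (y * a) /ℕ q
  ... | e , e≤ , s , eq′ = e′ , e′≤ , s , trans split (cong (_+ s * (+ q * (+ q) ^ k)) (sym (∑-suc _)))
    where
    open ≡-Reasoning
    r = + ((y * a) %ℕ q)
    z = (y * a) /ℕ q
    v = powers (+ q) (+ M) k
    e′ : Fin (suc k) → ℤ
    e′ zero    = r
    e′ (suc l) = e l
    e′≤ : ∀ l → ∣ e′ l ∣ ℕ.≤ q
    e′≤ zero    = ℕ.<⇒≤ (n%ℕd<d (y * a) q)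
    e′≤ (suc l) = e≤ l
    unit : ∀ y b q → y ≡ y * (1ℤ + b * q) - y * b * q
    unit = solve-∀
    assoc : ∀ y a p b q → y * (a * p) - y * b * q ≡ y * a * p - y * b * q
    assoc = solve-∀
    expand : ∀ r z q p x → (r + z * q) * p - x * q ≡ r * p + q * (z * p - x)
    expand = solve-∀
    regroup : ∀ x q S s P → x + q * (S + s * P) ≡ x + q * S + s * (q * P)
    regroup = solve-∀
    split : y ≡ r * (+ M) ^ k + ∑ (λ l → e l * (+ q * v l)) + s * (+ q * (+ q) ^ k)
    split = begin
      y                                        ≡⟨ unit y b (+ q) ⟩
      y * (1ℤ + b * + q) - y * b * + q         ≡⟨ cong (λ x → y * x - y * b * + q) eq ⟨
      y * (a * (+ M) ^ k) - y * b * + q          ≡⟨ assoc y a ((+ M) ^ k) b (+ q) ⟩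
      y * a * (+ M) ^ k - y * b * + q            ≡⟨ cong (λ x → x * (+ M) ^ k - y * b * + q) (a≡a%ℕn+[a/ℕn]*n (y * a) q) ⟩
      (r + z * + q) * (+ M) ^ k - y * b * + q    ≡⟨ expand r z (+ q) ((+ M) ^ k) (y * b) ⟩
      r * (+ M) ^ k + + q * (z * (+ M) ^ k - y * b) ≡⟨ cong (λ x → r * (+ M) ^ k + + q * x) eq′ ⟩
      r * (+ M) ^ k + + q * (∑ (λ l → e l * v l) + s * (+ q) ^ k)
        ≡⟨ regroup (r * (+ M) ^ k) (+ q) (∑ (λ l → e l * v l)) s ((+ q) ^ k) ⟩
      r * (+ M) ^ k + + q * ∑ (λ l → e l * v l) + s * (+ q * (+ q) ^ k)
        ≡⟨ cong (λ x → r * (+ M) ^ k + x + s * (+ q * (+ q) ^ k))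
             (trans (∑-*ˡ (+ q) (λ l → e l * v l)) (∑-cong (λ l → *-left-comm (+ q) (e l) (v l)))) ⟩
      r * (+ M) ^ k + ∑ (λ l → e l * (+ q * v l)) + s * (+ q * (+ q) ^ k) ∎

-- k + 2 directions, any k of which span after multiplication by M: they satisfy the two relations
-- Σ Dⱼ = 0 and Σ j Dⱼ = 0, whose 2 × 2 minors are the differences of indices.
directions : ∀ {k} → (Fin k → ℤ) → Fin (suc (suc k)) → ℤ
directions v zero          = ∑ (λ l → + suc (toℕ l) * v l)
directions v (suc zero)    = ∑ (λ l → - + suc (suc (toℕ l)) * v l)
directions v (suc (suc l)) = v l

-- Both relations in one family: taking `a` to be an index makes the coefficient of that direction
-- vanish.
directions-relation : ∀ {k} (v : Fin k → ℤ) a → ∑ (λ j → (+ toℕ j - a) * directions v j) ≡ 0ℤ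
directions-relation {k} v a = begin
    ∑ (λ j → (+ toℕ j - a) * directions v j)
      ≡⟨ trans (∑-suc _) (cong (λ x → (0ℤ - a) * P + x) (∑-suc _)) ⟩
    (0ℤ - a) * P + ((1ℤ - a) * Q + R)
      ≡⟨ cong₂ (λ x y → x + (y + R)) (∑-*ˡ (0ℤ - a) (λ l → + suc (toℕ l) * v l))
                                      (∑-*ˡ (1ℤ - a) (λ l → - + suc (suc (toℕ l)) * v l)) ⟩
    ∑ p + (∑ q + R)  ≡⟨ cong (λ x → ∑ p + x) (∑-+ q r) ⟨
    ∑ p + ∑ (λ l → q l + r l)  ≡⟨ ∑-+ p (λ l → q l + r l) ⟨
    ∑ (λ l → p l + (q l + r l)) ≡⟨ ∑-cong (λ l → cancel (+ toℕ l) a (v l)) ⟩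
    ∑ {k} (λ _ → 0ℤ)  ≡⟨ ∑-zero k ⟩
    0ℤ ∎
  where
  open ≡-Reasoning
  p q r : Fin k → ℤ
  p l = (0ℤ - a) * (+ suc (toℕ l) * v l)
  q l = (1ℤ - a) * (- + suc (suc (toℕ l)) * v l)
  r l = (+ suc (suc (toℕ l)) - a) * v l
  P = ∑ (λ l → + suc (toℕ l) * v l)
  Q = ∑ (λ l → - + suc (suc (toℕ l)) * v l)
  R = ∑ r
  cancel : ∀ x a v → (0ℤ - a) * ((1ℤ + x) * v) +
    ((1ℤ - a) * (- (1ℤ + (1ℤ + x)) * v) + ((1ℤ + (1ℤ + x)) - a) * v) ≡ 0ℤ
  cancel = solve-∀

∣i-j∣≤ : ∀ {n} (i j : Fin (suc n)) → ∣ + toℕ i - + toℕ j ∣ ℕ.≤ n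
∣i-j∣≤ i j with ℕ.≤-total (toℕ i) (toℕ j)
... | inj₁ i≤j = subst (ℕ._≤ _) (sym (trans (cong ∣_∣ (ℤ.m-n≡m⊖n (toℕ i) (toℕ j))) (ℤ.∣⊖∣-≤ i≤j)))
  (ℕ.≤-trans (ℕ.m∸n≤m (toℕ j) (toℕ i)) (Fin.toℕ≤pred[n] j))
... | inj₂ j≤i = subst (ℕ._≤ _)
  (sym (trans (ℤ.∣i-j∣≡∣j-i∣ (+ toℕ i) (+ toℕ j)) (trans (cong ∣_∣ (ℤ.m-n≡m⊖n (toℕ j) (toℕ i))) (ℤ.∣⊖∣-≤ j≤i))))
  (ℕ.≤-trans (ℕ.m∸n≤m (toℕ i) (toℕ j)) (Fin.toℕ≤pred[n] i))

m∣n! : ∀ {m n} .{{_ : NonZero m}} → m ℕ.≤ n → m ℕ.∣ n !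
m∣n! {suc m} m≤n = ℕ.∣-trans (ℕ.m∣m*n (m !)) (ℕ.m≤n⇒m!∣n! m≤n)

-- A nonzero difference of indices is at most `n` in absolute value, hence divides `n !`. This is
-- why `M` is a factorial.
difference-divides : ∀ {n} (i j : Fin (suc n)) → i ≢ j →
  ∃ λ m → ∣ m ∣ ℕ.≤ n ! × m * (+ toℕ i - + toℕ j) ≡ + (n !)
difference-divides {n} i j i≢j = m , m≤ , sym eq
  where
  instance
    i-j≢0 : NonZero ∣ + toℕ i - + toℕ j ∣
    i-j≢0 = ℕ.≢-nonZero λ eq →
      i≢j (Fin.toℕ-injective (ℤ.+-injective (ℤ.i-j≡0⇒i≡j _ _ (ℤ.∣i∣≡0⇒i≡0 eq))))
  divisible : (+ toℕ i - + toℕ j) ℤ.∣ + (n !)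
  divisible = ℤ.∣ᵤ⇒∣ (m∣n! (∣i-j∣≤ i j))
  m = ℤ.quotient divisible
  eq = ℤ._∣_.equality divisible
  m≤ : ∣ m ∣ ℕ.≤ n !
  m≤ = subst (∣ m ∣ ℕ.≤_) (trans (sym (ℤ.abs-* m _)) (cong ∣_∣ (sym eq))) (ℕ.m≤m*n ∣ m ∣ _)

-- The two omitted indices are p and punchIn p r.
omit : ∀ {k} → Fin (suc (suc k)) → Fin (suc k) → Fin k → Fin (suc (suc k))
omit p r i = punchIn p (punchIn r i)

∑-omit : ∀ {k} (f : Fin (suc (suc k)) → ℤ) p r → ∑ f ≡ f p + (f (punchIn p r) + ∑ (f ∘ omit p r))
∑-omit f p r = trans (∑-remove f p) (cong (λ x → f p + x) (∑-remove (f ∘ punchIn p) r))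

M·direction-small : ∀ {k} N (v : Fin k → ℤ) p r j →
  SmallCombinations.Small N (directions v ∘ omit p r) (suc k ! ℕ.* suc k) (+ (suc k !) * directions v j)
M·direction-small {k} N v p r j = by-cases
  where
  open SmallCombinations N (directions v ∘ omit p r)
  D = directions v
  M = suc k !
  r′ = punchIn p r
  D* = D ∘ omit p r

  eliminate : ∀ (a b : Fin (suc (suc k))) → a ≢ b →
    ((+ toℕ a - + toℕ b) * D a + ∑ (λ i → (+ toℕ (omit p r i) - + toℕ b) * D* i) ≡ 0ℤ) →
    Small (M ℕ.* suc k) (+ M * D a)
  eliminate a b a≢b rel with difference-divides a b a≢b
  ... | m , m≤ , eq =
    (λ i → - m * (+ toℕ (omit p r i) - + toℕ b)) ,
    (λ i → subst (ℕ._≤ _) (sym (ℤ.abs-* (- m) _))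
      (ℕ.*-mono-≤ (subst (ℕ._≤ M) (sym (ℤ.∣-i∣≡∣i∣ m)) m≤) (∣i-j∣≤ (omit p r i) b))) ,
    -- The relation holds in ℤ itself, so the multiple of `N` is 0.
    0ℤ , (begin
      + M * D a        ≡⟨ cong (_* D a) eq ⟨
      m * δ * D a      ≡⟨ solve-for m δ (D a) S ⟩
      m * (δ * D a + S) + - m * S  ≡⟨ cong (λ x → m * x + - m * S) rel ⟩
      m * 0ℤ + - m * S  ≡⟨ tidy m (- m * S) N ⟩
      - m * S + 0ℤ * N ≡⟨ cong (_+ 0ℤ * N) (trans (∑-*ˡ (- m) _) (∑-cong (λ i → sym (ℤ.*-assoc (- m) _ (D* i))))) ⟩
      ∑ (λ i → - m * (+ toℕ (omit p r i) - + toℕ b) * D* i) + 0ℤ * N ∎)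
    where
    open ≡-Reasoning
    δ = + toℕ a - + toℕ b
    S = ∑ (λ i → (+ toℕ (omit p r i) - + toℕ b) * D* i)
    solve-for : ∀ m δ d S → m * δ * d ≡ m * (δ * d + S) + - m * S
    solve-for = solve-∀
    tidy : ∀ m x N → m * 0ℤ + x ≡ x + 0ℤ * N
    tidy = solve-∀

  relation : ∀ b → (+ toℕ p - + toℕ b) * D p +
    ((+ toℕ r′ - + toℕ b) * D r′ + ∑ (λ i → (+ toℕ (omit p r i) - + toℕ b) * D* i)) ≡ 0ℤ
  relation b = trans (sym (∑-omit (λ j → (+ toℕ j - + toℕ b) * D j) p r)) (directions-relation v (+ toℕ b))

  drop-first : ∀ x d e → (x - x) * d + e ≡ e
  drop-first = solve-∀
  drop-second : ∀ y x d e → y + ((x - x) * d + e) ≡ y + e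
  drop-second = solve-∀

  by-cases : Small (M ℕ.* suc k) (+ M * D j)
  by-cases with p Fin.≟ j
  ... | yes refl = eliminate p r′ (Fin.punchInᵢ≢i p r ∘ sym)
    (trans (sym (drop-second ((+ toℕ p - + toℕ r′) * D p) (+ toℕ r′) (D r′) _)) (relation r′))
  ... | no p≢j with r Fin.≟ punchOut p≢j
  ...   | yes refl = subst (λ x → Small (M ℕ.* suc k) (+ M * D x)) (Fin.punchIn-punchOut p≢j)
    (eliminate r′ p (Fin.punchInᵢ≢i p r)
      (trans (sym (drop-first (+ toℕ p) (D p) _)) (relation p)))
  ...   | no r≢j = subst (λ x → Small (M ℕ.* suc k) (+ M * D x))
    (trans (cong (punchIn p) (Fin.punchIn-punchOut r≢j)) (Fin.punchIn-punchOut p≢j))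
    (small-weaken (ℕ.*-monoʳ-≤ M (ℕ.s≤s ℕ.z≤n)) (small-* (+ M) ℕ.≤-refl (small-generator (punchOut r≢j))))

-- Coordinates in any `k` of the directions.

module Covering (k : ℕ) where

  M : ℕ
  M = suc k !

  -- All three depend on `k` alone, so they stay fixed as `t` grows. In `M-bound`, `suc k` is the
  -- largest difference of indices; in `q-bound`, it bounds the coefficients of the two added
  -- directions. `slack` is the `B` of `cover`.
  M-bound q-bound slack : ℕ
  M-bound = M ℕ.* suc k
  q-bound = M-bound ℕ.+ k ℕ.* (suc k ℕ.* M-bound)
  slack   = k ℕ.* (suc (k ℕ.* M-bound) ℕ.* q-bound)

  module _ (t : ℕ) where
    open Digits M t public using (q)
    open Digits M t using (digits; inverse-power)

    D : Fin (suc (suc k)) → ℤ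
    D = directions (powers (+ q) (+ M) k)

    module _ (p : Fin (suc (suc k))) (r : Fin (suc k)) where
      private
        N : ℤ
        N = (+ q) ^ k
        v : Fin k → ℤ
        v = powers (+ q) (+ M) k
        D* : Fin k → ℤ
        D* = D ∘ omit p r
      open SmallCombinations N D*
      open Reduction q N D* using (cover)

      M·D-small : ∀ j → Small M-bound (+ M * D j)
      M·D-small = M·direction-small N v p r

      -- Multiplication by `q` turns `v l` into `M` times the next power, itself a direction, or
      -- into 0 modulo `N`.
      q·v-small : ∀ l → Small M-bound (+ q * v l)
      q·v-small l with powers-step (+ q) (+ M) k l
      ... | inj₁ (l′ , eq) = subst (Small M-bound) (sym eq) (M·D-small (suc (suc l′)))
      ... | inj₂ eq        = subst (Small M-bound) (trans (ℤ.*-identityˡ N) (sym eq))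
        (small-weaken ℕ.z≤n (small-multiple 1ℤ))

      q·combination-small : ∀ (c : Fin k → ℤ) → (∀ l → ∣ c l ∣ ℕ.≤ suc k) →
        Small q-bound (+ q * ∑ (λ l → c l * v l))
      q·combination-small c c≤ = subst (Small q-bound)
        (sym (trans (∑-*ˡ (+ q) (λ l → c l * v l)) (∑-cong (λ l → *-left-comm (+ q) (c l) (v l)))))
        (small-weaken (ℕ.m≤n+m (k ℕ.* (suc k ℕ.* M-bound)) M-bound)
          (small-sum c (λ l → + q * v l) c≤ q·v-small))

      q·D-small : ∀ j → Small q-bound (+ q * D j)
      q·D-small zero          = q·combination-small (λ l → + suc (toℕ l)) (λ l → ℕ.m≤n⇒m≤1+n (Fin.toℕ<n l))
      q·D-small (suc zero)    = q·combination-small (λ l → - + suc (suc (toℕ l))) (λ l → ℕ.s≤s (Fin.toℕ<n l))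
      q·D-small (suc (suc l)) = small-weaken (ℕ.m≤m+n M-bound _) (q·v-small l)

      -- Modulo `N`, `y` is `M` times `y a` with `a` the inverse of `M`. The digits of `y a` are at
      -- most `q`, and each `M v l` has constant bound, so the total is linear in `q`.
      all-small : ∀ y → Small (k ℕ.* M-bound ℕ.* q) y
      all-small y with inverse-power k
      ... | a , b , eq with digits k (y * a)
      ...   | e , e≤ , s , eq′ = subst₂ Small bound (sym value)
        (small-+ (small-sum e (λ l → + M * v l) e≤ (λ l → M·D-small (suc (suc l))))
                 (small-multiple (+ M * s - y * b)))
        where
        open ≡-Reasoning
        bound : k ℕ.* (q ℕ.* M-bound) ℕ.+ 0 ≡ k ℕ.* M-bound ℕ.* q
        bound = trans (ℕ.+-identityʳ _)
          (trans (cong (k ℕ.*_) (ℕ.*-comm q M-bound)) (sym (ℕ.*-assoc k M-bound q)))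
        unit : ∀ y b N → y ≡ y * (1ℤ + b * N) - y * b * N
        unit = solve-∀
        rotate : ∀ y a M z → y * (a * M) - z ≡ M * (y * a) - z
        rotate = solve-∀
        regroup : ∀ M S s N y b → M * (S + s * N) - y * b * N ≡ M * S + (M * s - y * b) * N
        regroup = solve-∀
        value : y ≡ ∑ (λ l → e l * (+ M * v l)) + (+ M * s - y * b) * N
        value = begin
          y                                   ≡⟨ unit y b N ⟩
          y * (1ℤ + b * N) - y * b * N        ≡⟨ cong (λ x → y * x - y * b * N) eq ⟨
          y * (a * + M) - y * b * N           ≡⟨ rotate y a (+ M) (y * b * N) ⟩
          + M * (y * a) - y * b * N           ≡⟨ cong (λ x → + M * x - y * b * N) eq′ ⟩
          + M * (∑ (λ l → e l * v l) + s * N) - y * b * N ≡⟨ regroup (+ M) (∑ (λ l → e l * v l)) s N y b ⟩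
          + M * ∑ (λ l → e l * v l) + (+ M * s - y * b) * N
            ≡⟨ cong (_+ (+ M * s - y * b) * N) (trans (∑-*ˡ (+ M) (λ l → e l * v l))
                 (∑-cong (λ l → *-left-comm (+ M) (e l) (v l)))) ⟩
          ∑ (λ l → e l * (+ M * v l)) + (+ M * s - y * b) * N ∎

      covering : ∀ y → Σ (Fin k → ℕ) λ x → (∀ i → x i ℕ.< q ℕ.+ (slack ℕ.+ slack)) ×
        ∃ λ s → y ≡ ∑ (λ i → + x i * D (omit p r i)) + s * N
      covering = cover {K = k ℕ.* M-bound} {C = q-bound} all-small (λ i → q·D-small (omit p r i))

directionsAt : ∀ k → ℕ → ℕ → Fin (suc (suc k)) → ℤ
directionsAt k M q = directions (powers (+ q) (+ M) k)

Covers : ℕ → ℕ → ℕ → Set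
Covers k M slack = ∀ t p r y → let q = suc (M ℕ.* t) in
  Σ (Fin k → ℕ) λ x → (∀ i → x i ℕ.< q ℕ.+ slack) ×
  ∃ λ s → y ≡ ∑ (λ i → + x i * directionsAt k M q (omit p r i)) + s * (+ q) ^ k

abstract
  -- Sealed by `abstract`: from here on `M` and `slack` are unspecified constants, absorbed into
  -- O(1) terms. The doubling comes from the shift in `cover`.
  covers : ∀ k → ∃₂ λ M slack → NonZero M × Covers k M slack
  covers k = M , slack ℕ.+ slack , (suc k ℕ.!≢0) , covering
    where open Covering k

-- Circulant graphs

remainder-unique : ∀ n .{{_ : NonZero n}} {r r′} → r ℕ.< n → r′ ℕ.< n → ∀ s → + r ≡ + r′ + s * + n → r ≡ r′
remainder-unique n {r} {r′} r< r′< (+ s) eq = begin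
    r                       ≡⟨ ℕ.m<n⇒m%n≡m r< ⟨
    r ℕ.% n                 ≡⟨ cong (ℕ._% n) (ℤ.+-injective (trans eq (cong (λ x → + r′ + x) (sym (ℤ.pos-* s n))))) ⟩
    (r′ ℕ.+ s ℕ.* n) ℕ.% n  ≡⟨ ℕ.[m+kn]%n≡m%n r′ s n ⟩
    r′ ℕ.% n                ≡⟨ ℕ.m<n⇒m%n≡m r′< ⟩
    r′                      ∎
  where open ≡-Reasoning
-- A negative multiple becomes positive on exchanging the two remainders.
remainder-unique n {r} {r′} r< r′< -[1+ s ] eq = sym (remainder-unique n r′< r< (+ suc s) (begin
    + r′                                       ≡⟨ cancel (+ r′) -[1+ s ] (+ n) ⟩
    + r′ + -[1+ s ] * + n + - -[1+ s ] * + n   ≡⟨ cong (_+ + suc s * + n) eq ⟨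
    + r + + suc s * + n                        ∎))
  where
  open ≡-Reasoning
  cancel : ∀ r s n → r ≡ r + s * n + - s * n
  cancel = solve-∀

module _ {n : ℕ} {{_ : NonZero n}} where

  residue : ℤ → Fin n
  residue z = fromℕ< (n%ℕd<d z n)

  toℕ-residue : ∀ z → + toℕ (residue z) ≡ z + - (z /ℕ n) * + n
  toℕ-residue z = begin
    + toℕ (residue z)                                        ≡⟨ cong +_ (Fin.toℕ-fromℕ< (n%ℕd<d z n)) ⟩
    + (z %ℕ n)                                               ≡⟨ cancel (+ (z %ℕ n)) (z /ℕ n) (+ n) ⟩
    (+ (z %ℕ n) + (z /ℕ n) * + n) + - (z /ℕ n) * + n         ≡⟨ cong (_+ - (z /ℕ n) * + n) (a≡a%ℕn+[a/ℕn]*n z n) ⟨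
    z + - (z /ℕ n) * + n                                     ∎
    where
    open ≡-Reasoning
    cancel : ∀ r s n → r ≡ (r + s * n) + - s * n
    cancel = solve-∀

  residue-unique : ∀ (u : Fin n) z s → + toℕ u ≡ z + s * + n → u ≡ residue z
  residue-unique u z s eq = Fin.toℕ-injective (remainder-unique n (Fin.toℕ<n u) (Fin.toℕ<n (residue z))
    (s + z /ℕ n) (trans eq (trans (regroup z s (z /ℕ n) (+ n))
      (cong (_+ (s + z /ℕ n) * + n) (sym (toℕ-residue z))))))
    where
    regroup : ∀ z s x n → z + s * n ≡ (z + - x * n) + (s + x) * n
    regroup = solve-∀

  residue-cong : ∀ {y z} s → y ≡ z + s * + n → residue y ≡ residue z
  residue-cong {y} {z} s refl = residue-unique (residue y) z (s + - (y /ℕ n))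
    (trans (toℕ-residue y) (regroup z s (y /ℕ n) (+ n)))
    where
    regroup : ∀ z s x n → z + s * n + - x * n ≡ z + (s + - x) * n
    regroup = solve-∀

  residue-toℕ : ∀ u → residue (+ toℕ u) ≡ u
  residue-toℕ u = sym (residue-unique u (+ toℕ u) 0ℤ (sym (ℤ.+-identityʳ _)))

  residue-+ : ∀ a z → residue (a + + toℕ (residue z)) ≡ residue (a + z)
  residue-+ a z = residue-cong {z = a + z} (- (z /ℕ n)) (trans (cong (λ x → a + x) (toℕ-residue z)) (sym (ℤ.+-assoc a z _)))

  addMod≡residue : ∀ u s → addMod u s ≡ residue (+ toℕ u + + toℕ s)
  addMod≡residue u s = Fin.toℕ-injective (trans (Fin.toℕ-fromℕ< (ℕ.m%n<n (toℕ u ℕ.+ toℕ s) n))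
    (sym (Fin.toℕ-fromℕ< (n%ℕd<d (+ (toℕ u ℕ.+ toℕ s)) n))))

  addMod-zero : ∀ u → addMod u (0 ℕ.mod n) ≡ u
  addMod-zero u = begin
    addMod u (0 ℕ.mod n)                     ≡⟨ addMod≡residue u (0 ℕ.mod n) ⟩
    residue (+ toℕ u + + toℕ (0 ℕ.mod n))    ≡⟨ residue-+ (+ toℕ u) 0ℤ ⟩
    residue (+ toℕ u + 0ℤ)                   ≡⟨ cong residue (ℤ.+-identityʳ (+ toℕ u)) ⟩
    residue (+ toℕ u)                        ≡⟨ residue-toℕ u ⟩
    u                                        ∎
    where open ≡-Reasoning

  -- A residue 0 cannot lie in a connection set, but adding it does not move the vertex; such steps
  -- are skipped, whence `j ≤ k` instead of equality.
  walk-by-residues : ∀ (S : Subset n) k (z : Fin k → ℤ) →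
    (∀ i → residue (z i) ≡ 0 ℕ.mod n ⊎ residue (z i) ∈ S) →
    ∀ u → ∃ λ j → j ℕ.≤ k × Walk S j u (residue (+ toℕ u + ∑ z))
  walk-by-residues S zero z z∈ u = 0 , ℕ.z≤n , subst (Walk S 0 u) (sym (begin
    residue (+ toℕ u + ∑ z) ≡⟨ cong (λ x → residue (+ toℕ u + x)) (∑-empty z) ⟩
    residue (+ toℕ u + 0ℤ)  ≡⟨ cong residue (ℤ.+-identityʳ (+ toℕ u)) ⟩
    residue (+ toℕ u)       ≡⟨ residue-toℕ u ⟩
    u                       ∎)) here
    where open ≡-Reasoning
  walk-by-residues S (suc k) z z∈ u
    with walk-by-residues S k (z ∘ suc) (z∈ ∘ suc) (addMod u (residue (z zero)))
  ... | j , j≤k , w = extend (z∈ zero)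
    where
    open ≡-Reasoning
    u′ = addMod u (residue (z zero))
    shift : ∀ u z x S n → u + z + x * n + S ≡ u + (z + S) + x * n
    shift = solve-∀
    target : residue (+ toℕ u′ + ∑ (z ∘ suc)) ≡ residue (+ toℕ u + ∑ z)
    target = trans (residue-cong {z = + toℕ u + (z zero + ∑ (z ∘ suc))} (- ((+ toℕ u + z zero) /ℕ n)) (begin
        + toℕ u′ + ∑ (z ∘ suc)
          ≡⟨ cong (λ x → + toℕ x + ∑ (z ∘ suc))
               (trans (addMod≡residue u (residue (z zero))) (residue-+ (+ toℕ u) (z zero))) ⟩
        + toℕ (residue (+ toℕ u + z zero)) + ∑ (z ∘ suc)
          ≡⟨ cong (_+ ∑ (z ∘ suc)) (toℕ-residue (+ toℕ u + z zero)) ⟩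
        + toℕ u + z zero + - ((+ toℕ u + z zero) /ℕ n) * + n + ∑ (z ∘ suc)
          ≡⟨ shift (+ toℕ u) (z zero) (- ((+ toℕ u + z zero) /ℕ n)) (∑ (z ∘ suc)) (+ n) ⟩
        + toℕ u + (z zero + ∑ (z ∘ suc)) + - ((+ toℕ u + z zero) /ℕ n) * + n ∎))
      (cong (λ x → residue (+ toℕ u + x)) (sym (∑-suc z)))
    extend : residue (z zero) ≡ 0 ℕ.mod n ⊎ residue (z zero) ∈ S →
      ∃ λ j → j ℕ.≤ suc k × Walk S j u (residue (+ toℕ u + ∑ z))
    extend (inj₁ eq) = j , ℕ.m≤n⇒m≤1+n j≤k ,
      subst₂ (Walk S j) (trans (cong (addMod u) eq) (addMod-zero u)) target w
    extend (inj₂ s∈S) = suc j , ℕ.s≤s j≤k , step (residue (z zero)) s∈S (subst (Walk S j u′) target w)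

-- Subsets of prescribed size.

fromList : ∀ {n} → List (Fin n) → Subset n
fromList []       = ⊥
fromList (x ∷ xs) = ⁅ x ⁆ ∪ fromList xs

∈-fromList : ∀ {n x} {xs : List (Fin n)} → x ∈ˡ xs → x ∈ fromList xs
∈-fromList {xs = x ∷ xs} (Any.here refl) = Sub.x∈p∪q⁺ (inj₁ (Sub.x∈⁅x⁆ x))
∈-fromList {xs = x ∷ xs} (Any.there x∈)  = Sub.x∈p∪q⁺ (inj₂ (∈-fromList x∈))

∣p∪q∣≤∣p∣+∣q∣ : ∀ {n} (p q : Subset n) → ∣ p ∪ q ∣ˢ ℕ.≤ ∣ p ∣ˢ ℕ.+ ∣ q ∣ˢ
∣p∪q∣≤∣p∣+∣q∣ []            []            = ℕ.z≤n
∣p∪q∣≤∣p∣+∣q∣ (outside ∷ p) (outside ∷ q) = ∣p∪q∣≤∣p∣+∣q∣ p q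
∣p∪q∣≤∣p∣+∣q∣ (outside ∷ p) (inside ∷ q)  =
  ℕ.≤-trans (ℕ.s≤s (∣p∪q∣≤∣p∣+∣q∣ p q)) (ℕ.≤-reflexive (sym (ℕ.+-suc ∣ p ∣ˢ ∣ q ∣ˢ)))
∣p∪q∣≤∣p∣+∣q∣ (inside ∷ p)  (outside ∷ q) = ℕ.s≤s (∣p∪q∣≤∣p∣+∣q∣ p q)
∣p∪q∣≤∣p∣+∣q∣ (inside ∷ p)  (inside ∷ q)  =
  ℕ.s≤s (ℕ.≤-trans (∣p∪q∣≤∣p∣+∣q∣ p q) (ℕ.+-monoʳ-≤ ∣ p ∣ˢ (ℕ.n≤1+n ∣ q ∣ˢ)))

∣fromList∣≤ : ∀ {n} (xs : List (Fin n)) → ∣ fromList xs ∣ˢ ℕ.≤ length xs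
∣fromList∣≤ {n} []       = ℕ.≤-reflexive (Sub.∣⊥∣≡0 n)
∣fromList∣≤ (x ∷ xs) = ℕ.≤-trans (∣p∪q∣≤∣p∣+∣q∣ ⁅ x ⁆ (fromList xs))
  (ℕ.+-mono-≤ (ℕ.≤-reflexive (Sub.∣⁅x⁆∣≡1 x)) (∣fromList∣≤ xs))

-- Greedy from the left: a position outside `p` is left out as long as the remainder of `q` can
-- still supply `d` elements.
intermediate-subset : ∀ {n} (p q : Subset n) d → p ⊆ q → ∣ p ∣ˢ ℕ.≤ d → d ℕ.≤ ∣ q ∣ˢ →
  ∃ λ s → p ⊆ s × s ⊆ q × ∣ s ∣ˢ ≡ d
intermediate-subset []            []            d       p⊆q p≤ d≤ = [] , (λ ()) , (λ ()) , sym (ℕ.n≤0⇒n≡0 d≤)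
intermediate-subset (inside ∷ p)  (outside ∷ q) d       p⊆q p≤ d≤ with () ← p⊆q here
intermediate-subset (inside ∷ p)  (inside ∷ q)  (suc d) p⊆q p≤ d≤
  with intermediate-subset p q d (Sub.drop-∷-⊆ p⊆q) (ℕ.s≤s⁻¹ p≤) (ℕ.s≤s⁻¹ d≤)
... | s , p⊆s , s⊆q , eq = inside ∷ s , Sub.s⊆s p⊆s , Sub.s⊆s s⊆q , cong suc eq
intermediate-subset (outside ∷ p) (outside ∷ q) d       p⊆q p≤ d≤
  with intermediate-subset p q d (Sub.drop-∷-⊆ p⊆q) p≤ d≤
... | s , p⊆s , s⊆q , eq = outside ∷ s , Sub.s⊆s p⊆s , Sub.s⊆s s⊆q , eq
intermediate-subset (outside ∷ p) (inside ∷ q)  d       p⊆q p≤ d≤ with d ℕ.≤? ∣ q ∣ˢ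
-- Here `d` is exactly the size of the whole upper set, so all of it is taken.
... | no d≰  = inside ∷ q , p⊆q , (λ x∈ → x∈) , ℕ.≤-antisym (ℕ.≰⇒> d≰) d≤
... | yes d≤q with intermediate-subset p q d (Sub.drop-∷-⊆ p⊆q) p≤ d≤q
...   | s , p⊆s , s⊆q , eq = outside ∷ s , Sub.s⊆s p⊆s , Sub.out⊆ s⊆q , eq

-- Counting short walks, for the lower bound on the diameter.

elements : ∀ {n} → Subset n → List (Fin n)
elements []            = []
elements (inside ∷ p)  = zero ∷ map suc (elements p)
elements (outside ∷ p) = map suc (elements p)

length-elements : ∀ {n} (p : Subset n) → length (elements p) ≡ ∣ p ∣ˢ
length-elements []            = refl
length-elements (inside ∷ p)  = cong suc (trans (List.length-map suc (elements p)) (length-elements p))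
length-elements (outside ∷ p) = trans (List.length-map suc (elements p)) (length-elements p)

∈-elements : ∀ {n x} {p : Subset n} → x ∈ p → x ∈ˡ elements p
∈-elements {p = inside ∷ p}  here       = Any.here refl
∈-elements {p = inside ∷ p}  (there x∈) = Any.there (∈-map⁺ suc (∈-elements x∈))
∈-elements {p = outside ∷ p} (there x∈) = ∈-map⁺ suc (∈-elements x∈)

length-concatMap : ∀ {A B : Set} (f : A → List B) {c} → (∀ x → length (f x) ≡ c) →
  ∀ xs → length (concatMap f xs) ≡ length xs ℕ.* c
length-concatMap f eq []       = refl
length-concatMap f eq (x ∷ xs) = trans (List.length-++ (f x)) (cong₂ ℕ._+_ (eq x) (length-concatMap f eq xs))

-- Pigeonhole: if every vertex occurred, its position in `xs` would inject `Fin n` into the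
-- positions of a shorter list.
missing-element : ∀ {n} (xs : List (Fin n)) → length xs ℕ.< n → ∃ λ v → ¬ v ∈ˡ xs
missing-element {n} xs len< = Fin.¬∀⟶∃¬ n (_∈ˡ xs) (_∈? xs)
    λ all∈ → ℕ.<⇒≱ len< (Fin.injective⇒≤ {f = λ v → Any.index (all∈ v)}
      λ {x} {y} → index-injective (setoid (Fin n)) (all∈ x) (all∈ y))
  where open DecMembership Fin._≟_ using (_∈?_)

module _ {n : ℕ} {{_ : NonZero n}} (S : Subset n) where

  -- One entry per word of length `j`, with repetitions, which makes the length an exact power.
  sphere : ℕ → Fin n → List (Fin n)
  sphere zero    u = u ∷ []
  sphere (suc j) u = concatMap (λ s → sphere j (addMod u s)) (elements S)

  ∈-sphere : ∀ {j u v} → Walk S j u v → v ∈ˡ sphere j u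
  ∈-sphere here            = Any.here refl
  ∈-sphere {suc j} {u} (step s s∈S w) = ∈-concatMap⁺ (λ s → sphere j (addMod u s))
    (Any.map (λ { refl → ∈-sphere w }) (∈-elements s∈S))

  length-sphere : ∀ j u → length (sphere j u) ≡ ∣ S ∣ˢ ℕ.^ j
  length-sphere zero    u = refl
  length-sphere (suc j) u = trans
    (length-concatMap (λ s → sphere j (addMod u s)) (λ s → length-sphere j (addMod u s)) (elements S))
    (cong (ℕ._* ∣ S ∣ˢ ℕ.^ j) (length-elements S))

  ball : ℕ → Fin n → List (Fin n)
  ball zero    u = []
  ball (suc k) u = sphere k u ++ ball k u

  ∈-ball : ∀ {k j u v} → j ℕ.< k → Walk S j u v → v ∈ˡ ball k u
  ∈-ball {suc k} {j} {u} j<k w with ℕ.m≤n⇒m<n∨m≡n (ℕ.s≤s⁻¹ j<k)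
  ... | inj₁ j<k′ = ∈-++⁺ʳ (sphere k u) (∈-ball j<k′ w)
  ... | inj₂ refl = ∈-++⁺ˡ (∈-sphere w)

  -- Each of the `k` spheres is bounded by the largest power. The exponent `m` is separate from `k`
  -- so that it stays fixed in the induction.
  length-ball : ∀ .{{_ : NonZero ∣ S ∣ˢ}} m k u → k ℕ.≤ suc m → length (ball k u) ℕ.≤ k ℕ.* ∣ S ∣ˢ ℕ.^ m
  length-ball m zero    u k≤ = ℕ.z≤n
  length-ball m (suc k) u k≤ = ℕ.≤-trans (ℕ.≤-reflexive (List.length-++ (sphere k u)))
    (ℕ.+-mono-≤ (ℕ.≤-trans (ℕ.≤-reflexive (length-sphere k u)) (ℕ.^-monoʳ-≤ ∣ S ∣ˢ (ℕ.s≤s⁻¹ k≤)))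
                (length-ball m k u (ℕ.<⇒≤ k≤)))

  unreached : ∀ .{{_ : NonZero ∣ S ∣ˢ}} k .{{_ : NonZero k}} → k ℕ.* ∣ S ∣ˢ ℕ.^ ℕ.pred k ℕ.< n →
    ∀ u → ∃ λ v → ∀ j → j ℕ.< k → ¬ Walk S j u v
  unreached k@(suc k₀) small u
    with missing-element (ball k u) (ℕ.≤-<-trans (length-ball k₀ k u ℕ.≤-refl) small)
  ... | v , v∉ = v , λ j j<k w → v∉ (∈-ball j<k w)

pos-sum : ∀ {m} (f : Fin m → ℕ) → + sum f ≡ ∑ (λ i → + f i)
pos-sum {zero}  f = sym (∑-empty _)
pos-sum {suc m} f = trans (cong (λ x → + f zero + x) (pos-sum (f ∘ suc))) (sym (∑-suc (λ i → + f i)))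

pos-^ : ∀ q k → + (q ℕ.^ k) ≡ (+ q) ^ k
pos-^ q zero    = refl
pos-^ q (suc k) = trans (ℤ.pos-* q (q ℕ.^ k)) (cong (λ x → + q * x) (pos-^ q k))

-- Exactly `k` distinct indices are summed, as `k` and no fewer distinct directions are used to
-- span; they are given by the pair left out.
OmitSumsCover : (k w : ℕ) .{{_ : NonZero w}} → (Fin (suc (suc k)) → ℕ) → Set
OmitSumsCover k w β = ∀ (c : Fin w) → ∃₂ λ p r → sum (λ i → β (omit p r i)) ℕ.% w ≡ toℕ c

module Circulant (k w q slack n : ℕ) .{{_ : NonZero w}} {{n≢0 : NonZero n}} (n≡ : + n ≡ + w * (+ q) ^ k)
  (D : Fin (suc (suc k)) → ℤ)
  (covering : ∀ p r y → Σ (Fin k → ℕ) λ x → (∀ i → x i ℕ.< q ℕ.+ slack) ×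
    ∃ λ s → y ≡ ∑ (λ i → + x i * D (omit p r i)) + s * (+ q) ^ k)
  (β : Fin (suc (suc k)) → ℕ) (sums-cover : OmitSumsCover k w β) where

  X : ℕ
  X = q ℕ.+ slack

  -- The offset `β j` alone decides the class modulo `w`; the multiple of `w` is free to adjust the
  -- quotient modulo `q^k`.
  generator : Fin (suc (suc k)) → ℕ → ℤ
  generator j x = + β j + + x * (+ w * D j)

  generators : List (Fin n)
  generators = concatMap (λ j → map (λ x → residue (generator j x)) (upTo X)) (allFin (suc (suc k)))

  length-generators : length generators ≡ suc (suc k) ℕ.* X
  length-generators = trans
    (length-concatMap (λ j → map (λ x → residue (generator j x)) (upTo X))
      (λ j → trans (List.length-map _ (upTo X)) (List.length-upTo X)) (allFin (suc (suc k))))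
    (cong (ℕ._* X) (List.length-tabulate {n = suc (suc k)} (λ j → j)))

  ∈-generators : ∀ j x → x ℕ.< X → residue (generator j x) ∈ˡ generators
  ∈-generators j x x<X = ∈-concatMap⁺ (λ j → map (λ x → residue (generator j x)) (upTo X))
    (Any.map (λ { refl → ∈-map⁺ (λ x → residue (generator j x)) (∈-upTo⁺ x<X) }) (∈-allFin j))

  -- First the indices are chosen so that the offsets sum to `T` modulo `w`. The difference is then
  -- a multiple of `w`, and its quotient by `w` is covered by the chosen directions modulo `q^k`;
  -- multiplying by `w` gives a congruence modulo `n`.
  represent : ∀ T → Σ (Fin k → ℤ) λ z → (∀ i → residue (z i) ∈ˡ generators) × ∃ λ s → T ≡ ∑ z + s * + n
  represent T with sums-cover (fromℕ< (n%ℕd<d T w))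
  -- The remainders modulo `w` agree, so this difference of quotients is `(T - S) / w`, where `S` is
  -- the sum of the chosen offsets.
  ... | p , r , eq with covering p r ((T /ℕ w) - + (sum (λ i → β (omit p r i)) ℕ./ w))
  ...   | x , x< , s , eq′ = z , (λ i → ∈-generators (omit p r i) (x i) (x< i)) , s , (begin
      T                                            ≡⟨ a≡a%ℕn+[a/ℕn]*n T w ⟩
      + (T %ℕ w) + (T /ℕ w) * + w                  ≡⟨ cong (λ c → + c + (T /ℕ w) * + w)
        (sym (trans eq (Fin.toℕ-fromℕ< (n%ℕd<d T w)))) ⟩
      + (S ℕ.% w) + (T /ℕ w) * + w                 ≡⟨ shift (+ (S ℕ.% w)) (T /ℕ w) (+ (S ℕ./ w)) (+ w) ⟩
      (+ (S ℕ.% w) + + (S ℕ./ w) * + w) + + w * ((T /ℕ w) - + (S ℕ./ w))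
        ≡⟨ cong₂ (λ a b → a + + w * b) S≡ eq′ ⟩
      ∑ (λ i → + β (omit p r i)) + + w * (∑ (λ i → + x i * D (omit p r i)) + s * (+ q) ^ k)
        ≡⟨ expand (∑ (λ i → + β (omit p r i))) (+ w) (∑ (λ i → + x i * D (omit p r i))) s ((+ q) ^ k) ⟩
      (∑ (λ i → + β (omit p r i)) + + w * ∑ (λ i → + x i * D (omit p r i))) + s * (+ w * (+ q) ^ k)
        ≡⟨ cong₂ (λ a b → a + s * b) sum-z (sym n≡) ⟩
      ∑ z + s * + n                            ∎)
    where
    open ≡-Reasoning
    S = sum (λ i → β (omit p r i))
    z : Fin k → ℤ
    z i = generator (omit p r i) (x i)
    shift : ∀ a b c w → a + b * w ≡ (a + c * w) + w * (b - c)
    shift = solve-∀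
    expand : ∀ a w b s N → a + w * (b + s * N) ≡ (a + w * b) + s * (w * N)
    expand = solve-∀
    S≡ : + (S ℕ.% w) + + (S ℕ./ w) * + w ≡ ∑ (λ i → + β (omit p r i))
    S≡ = trans (sym (a≡a%ℕn+[a/ℕn]*n (+ S) w)) (pos-sum (λ i → β (omit p r i)))
    sum-z : ∑ (λ i → + β (omit p r i)) + + w * ∑ (λ i → + x i * D (omit p r i)) ≡ ∑ z
    sum-z = trans
      (cong (λ a → ∑ (λ i → + β (omit p r i)) + a) (trans (∑-*ˡ (+ w) (λ i → + x i * D (omit p r i)))
        (∑-cong (λ i → *-left-comm (+ w) (+ x i) (D (omit p r i))))))
      (sym (∑-+ (λ i → + β (omit p r i)) (λ i → + x i * (+ w * D (omit p r i)))))

  -- The nonzero generators number at most `d` and all nonzero residues `n - 1`, at least `d`. Any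
  -- set of size `d` in between still reaches everything within `k` steps, and the count of short
  -- walks rules out a smaller diameter.
  circulant : ∀ d .{{_ : NonZero d}} .{{_ : NonZero k}} → suc (suc k) ℕ.* X ℕ.≤ d →
    d ℕ.< n → k ℕ.* d ℕ.^ ℕ.pred k ℕ.< n → DCirc n d k
  circulant d enough d<n small
    with intermediate-subset (fromList generators ∩ ∁ ⁅ 0 ℕ.mod n ⁆) (∁ ⁅ 0 ℕ.mod n ⁆) d
      (Sub.p∩q⊆q (fromList generators) _)
      (ℕ.≤-trans (Sub.∣p∩q∣≤∣p∣ (fromList generators) _)
        (ℕ.≤-trans (∣fromList∣≤ generators) (ℕ.≤-trans (ℕ.≤-reflexive length-generators) enough)))
      (subst (d ℕ.≤_) (sym (trans (Sub.∣∁p∣≡n∸∣p∣ ⁅ 0 ℕ.mod n ⁆)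
        (cong (n ℕ.∸_) (Sub.∣⁅x⁆∣≡1 (0 ℕ.mod n))))) (ℕ.<⇒≤pred d<n))
  ... | S , ⊆S , S⊆ , refl = n≢0 , S ,
    ((λ 0∈S → Sub.x∈∁p⇒x∉p (S⊆ 0∈S) (Sub.x∈⁅x⁆ (0 ℕ.mod n))) , refl) ,
    reach , 0 ℕ.mod n , unreached S k small (0 ℕ.mod n)
    where
    into-S : ∀ x → x ∈ˡ generators → x ≡ 0 ℕ.mod n ⊎ x ∈ S
    into-S x x∈ with x Fin.≟ 0 ℕ.mod n
    ... | yes x≡0 = inj₁ x≡0
    ... | no  x≢0 = inj₂ (⊆S (Sub.x∈p∩q⁺ (∈-fromList x∈ , Sub.x∉p⇒x∈∁p (Sub.x≢y⇒x∉⁅y⁆ x≢0))))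
    reach : ∀ u v → ∃ λ j → j ℕ.≤ k × Walk S j u v
    reach u v with represent (+ toℕ v - + toℕ u)
    ... | z , z∈ , s , eq with walk-by-residues S k z (λ i → into-S _ (z∈ i)) u
    ...   | j , j≤k , walk = j , j≤k , subst (Walk S j u) (sym (residue-unique v (+ toℕ u + ∑ z) s (begin
        + toℕ v                           ≡⟨ unshift (+ toℕ u) (+ toℕ v) ⟩
        + toℕ u + (+ toℕ v - + toℕ u)     ≡⟨ cong (λ x → + toℕ u + x) eq ⟩
        + toℕ u + (∑ z + s * + n)     ≡⟨ ℤ.+-assoc (+ toℕ u) (∑ z) (s * + n) ⟨
        + toℕ u + ∑ z + s * + n       ∎))) walk
      where
      open ≡-Reasoning
      unshift : ∀ u v → v ≡ u + (v - u)
      unshift = solve-∀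

-- Asymptotics

*-^ : ∀ a b k → (a ℕ.* b) ℕ.^ k ≡ a ℕ.^ k ℕ.* b ℕ.^ k
*-^ a b zero    = refl
*-^ a b (suc k) = trans (cong (a ℕ.* b ℕ.*_) (*-^ a b k)) (interchange a b (a ℕ.^ k) (b ℕ.^ k))
  where
  interchange : ∀ a b c d → a ℕ.* b ℕ.* (c ℕ.* d) ≡ a ℕ.* c ℕ.* (b ℕ.* d)
  interchange = ℕ.solve-∀

-- Bernoulli's inequality (1 - A/d)^k ≥ 1 - k A/d, multiplied by d^(k+1).
power-loss : ∀ d A k → d ℕ.* d ℕ.^ k ℕ.≤ d ℕ.* (d ℕ.∸ A) ℕ.^ k ℕ.+ k ℕ.* A ℕ.* d ℕ.^ k
power-loss d A zero    = ℕ.m≤m+n (d ℕ.* 1) 0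
power-loss d A (suc k) = begin
    d ℕ.* (d ℕ.* D)                                        ≤⟨ ℕ.*-monoʳ-≤ d (power-loss d A k) ⟩
    d ℕ.* (d ℕ.* X ℕ.+ k ℕ.* A ℕ.* D)                      ≤⟨ ℕ.*-monoʳ-≤ d (ℕ.+-monoˡ-≤ (k ℕ.* A ℕ.* D) (ℕ.*-monoˡ-≤ X d≤)) ⟩
    d ℕ.* ((A ℕ.+ x) ℕ.* X ℕ.+ k ℕ.* A ℕ.* D)              ≡⟨ expand d x A k D X ⟩
    d ℕ.* (x ℕ.* X) ℕ.+ (A ℕ.* (d ℕ.* X) ℕ.+ k ℕ.* A ℕ.* (d ℕ.* D))
      ≤⟨ ℕ.+-monoʳ-≤ (d ℕ.* (x ℕ.* X)) (ℕ.+-monoˡ-≤ _ (ℕ.*-monoʳ-≤ A (ℕ.*-monoʳ-≤ d (ℕ.^-monoˡ-≤ k (ℕ.m∸n≤m d A))))) ⟩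
    d ℕ.* (x ℕ.* X) ℕ.+ (A ℕ.* (d ℕ.* D) ℕ.+ k ℕ.* A ℕ.* (d ℕ.* D))
      ≡⟨ cong (d ℕ.* (x ℕ.* X) ℕ.+_) (ℕ.*-distribʳ-+ (d ℕ.* D) A (k ℕ.* A)) ⟨
    d ℕ.* (x ℕ.* X) ℕ.+ suc k ℕ.* A ℕ.* (d ℕ.* D)          ∎
  where
  open ℕ.≤-Reasoning
  x = d ℕ.∸ A
  D = d ℕ.^ k
  X = x ℕ.^ k
  d≤ : d ℕ.≤ A ℕ.+ x
  d≤ = ℕ.m≤n+m∸n d A
  expand : ∀ d x A k D X → d ℕ.* ((A ℕ.+ x) ℕ.* X ℕ.+ k ℕ.* A ℕ.* D) ≡
    d ℕ.* (x ℕ.* X) ℕ.+ (A ℕ.* (d ℕ.* X) ℕ.+ k ℕ.* A ℕ.* (d ℕ.* D))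
  expand = ℕ.solve-∀

-- Bernoulli's inequality with a loss `k A / d` of at most one half.
half-power : ∀ d A k .{{_ : NonZero d}} → 2 ℕ.* (k ℕ.* A) ℕ.≤ d → d ℕ.^ k ℕ.≤ 2 ℕ.* (d ℕ.∸ A) ℕ.^ k
half-power d A k 2kA≤d = ℕ.*-cancelˡ-≤ d (ℕ.+-cancelʳ-≤ (d ℕ.* D) _ _ (begin
    d ℕ.* D ℕ.+ d ℕ.* D                               ≡⟨ double (d ℕ.* D) ⟩
    2 ℕ.* (d ℕ.* D)                                   ≤⟨ ℕ.*-monoʳ-≤ 2 (power-loss d A k) ⟩
    2 ℕ.* (d ℕ.* X ℕ.+ k ℕ.* A ℕ.* D)                 ≡⟨ expand d X (k ℕ.* A) D ⟩
    d ℕ.* (2 ℕ.* X) ℕ.+ 2 ℕ.* (k ℕ.* A) ℕ.* D         ≤⟨ ℕ.+-monoʳ-≤ (d ℕ.* (2 ℕ.* X)) (ℕ.*-monoˡ-≤ D 2kA≤d) ⟩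
    d ℕ.* (2 ℕ.* X) ℕ.+ d ℕ.* D                       ∎))
  where
  open ℕ.≤-Reasoning
  D = d ℕ.^ k
  X = (d ℕ.∸ A) ℕ.^ k
  double : ∀ x → x ℕ.+ x ≡ 2 ℕ.* x
  double = ℕ.solve-∀
  expand : ∀ d X b D → 2 ℕ.* (d ℕ.* X ℕ.+ b ℕ.* D) ≡ d ℕ.* (2 ℕ.* X) ℕ.+ 2 ℕ.* b ℕ.* D
  expand = ℕ.solve-∀

-- `ℓ q` runs through an arithmetic progression of step `ℓ M`; division with remainder finds the
-- last term that fits, so the loss against `d` does not depend on `d`.
best-modulus : ∀ ℓ M s d .{{_ : NonZero ℓ}} .{{_ : NonZero M}} → ℓ ℕ.* suc s ℕ.≤ d →
  ∃ λ t → ℓ ℕ.* (suc (M ℕ.* t) ℕ.+ s) ℕ.≤ d × d ℕ.∸ (ℓ ℕ.* suc s ℕ.+ ℓ ℕ.* M) ℕ.≤ ℓ ℕ.* suc (M ℕ.* t)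
best-modulus ℓ M s d a≤d = t , fits , tight
  where
  open ℕ.≤-Reasoning
  a = ℓ ℕ.* suc s
  b = ℓ ℕ.* M
  instance
    b≢0 : NonZero b
    b≢0 = ℕ.m*n≢0 ℓ M
  t = (d ℕ.∸ a) ℕ./ b
  regroup : ∀ ℓ s M t → ℓ ℕ.* (1 ℕ.+ M ℕ.* t ℕ.+ s) ≡ ℓ ℕ.* (1 ℕ.+ s) ℕ.+ t ℕ.* (ℓ ℕ.* M)
  regroup = ℕ.solve-∀
  fits : ℓ ℕ.* (suc (M ℕ.* t) ℕ.+ s) ℕ.≤ d
  fits = begin
    ℓ ℕ.* (suc (M ℕ.* t) ℕ.+ s) ≡⟨ regroup ℓ s M t ⟩
    a ℕ.+ t ℕ.* b               ≤⟨ ℕ.+-monoʳ-≤ a (ℕ.m/n*n≤m (d ℕ.∸ a) b) ⟩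
    a ℕ.+ (d ℕ.∸ a)             ≡⟨ ℕ.m+[n∸m]≡n a≤d ⟩
    d                           ∎
  swap : ∀ ℓ M t → t ℕ.* (ℓ ℕ.* M) ≡ ℓ ℕ.* (M ℕ.* t)
  swap = ℕ.solve-∀
  tight : d ℕ.∸ (a ℕ.+ b) ℕ.≤ ℓ ℕ.* suc (M ℕ.* t)
  tight = begin
    d ℕ.∸ (a ℕ.+ b)             ≡⟨ ℕ.∸-+-assoc d a b ⟨
    d ℕ.∸ a ℕ.∸ b               ≤⟨ ℕ.m≤n+o⇒m∸n≤o (d ℕ.∸ a) b (ℕ.≤-trans
      (ℕ.≤-reflexive (ℕ.m≡m%n+[m/n]*n (d ℕ.∸ a) b)) (ℕ.+-monoˡ-≤ (t ℕ.* b) (ℕ.m%n≤n (d ℕ.∸ a) b))) ⟩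
    t ℕ.* b                     ≡⟨ swap ℓ M t ⟩
    ℓ ℕ.* (M ℕ.* t)             ≤⟨ ℕ.*-monoʳ-≤ ℓ (ℕ.n≤1+n (M ℕ.* t)) ⟩
    ℓ ℕ.* suc (M ℕ.* t)         ∎

-- `A` is the loss from `best-modulus`. The conditions on `d` serve in turn to choose a modulus, to
-- have `d^k` at most twice `(d - A)^k`, and to make the `O(d^(k-1))` short walks fewer than `n`.
large-circulants : ∀ k w .{{_ : NonZero w}} β → 2 ℕ.≤ k → OmitSumsCover k w β →
  let ℓ = suc (suc k) in ∃ λ A → ∀ d → A ℕ.≤ d → 2 ℕ.* (k ℕ.* A) ℕ.≤ d → 2 ℕ.* ℓ ℕ.^ k ℕ.* k ℕ.< d →
  ∃ λ n → w ℕ.* (d ℕ.∸ A) ℕ.^ k ℕ.≤ ℓ ℕ.^ k ℕ.* n × DCirc n d k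
large-circulants k w β 2≤k sums-cover with covers k
... | M , slack , M≢0 , covering = A , construct
  where
  open ℕ.≤-Reasoning
  ℓ = suc (suc k)
  L = ℓ ℕ.^ k
  A = ℓ ℕ.* suc slack ℕ.+ ℓ ℕ.* M
  construct : ∀ d → A ℕ.≤ d → 2 ℕ.* (k ℕ.* A) ℕ.≤ d → 2 ℕ.* L ℕ.* k ℕ.< d →
    ∃ λ n → w ℕ.* (d ℕ.∸ A) ℕ.^ k ℕ.≤ L ℕ.* n × DCirc n d k
  construct d A≤d 2kA≤d 2Lk<d
    with best-modulus ℓ M slack d {{_}} {{M≢0}} (ℕ.≤-trans (ℕ.m≤m+n _ (ℓ ℕ.* M)) A≤d)
  ... | t , fits , tight = n , large ,
    Circulant.circulant k w q slack n {{n≢0 = n≢0}} n≡ (directionsAt k M q) (covering t) β sums-cover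
      d {{d≢0}} {{k≢0}} fits d<n small
    where
    q = suc (M ℕ.* t)
    n = w ℕ.* q ℕ.^ k
    x = d ℕ.∸ A
    n≢0 : NonZero n
    n≢0 = ℕ.m*n≢0 w (q ℕ.^ k)
      where instance _ = ℕ.m^n≢0 q k
    d≢0 : NonZero d
    d≢0 = ℕ.>-nonZero (ℕ.≤-<-trans ℕ.z≤n 2Lk<d)
    k≢0 : NonZero k
    k≢0 = ℕ.>-nonZero (ℕ.<⇒≤ 2≤k)
    n≡ : + n ≡ + w * (+ q) ^ k
    n≡ = trans (ℤ.pos-* w (q ℕ.^ k)) (cong (λ y → + w * y) (pos-^ q k))
    swap : ∀ w a b → w ℕ.* (a ℕ.* b) ≡ a ℕ.* (w ℕ.* b)
    swap = ℕ.solve-∀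
    large : w ℕ.* x ℕ.^ k ℕ.≤ L ℕ.* n
    large = begin
      w ℕ.* x ℕ.^ k              ≤⟨ ℕ.*-monoʳ-≤ w (ℕ.^-monoˡ-≤ k tight) ⟩
      w ℕ.* (ℓ ℕ.* q) ℕ.^ k      ≡⟨ cong (w ℕ.*_) (*-^ ℓ q k) ⟩
      w ℕ.* (L ℕ.* q ℕ.^ k)      ≡⟨ swap w L (q ℕ.^ k) ⟩
      L ℕ.* n                    ∎
    split : ∀ {j} .{{_ : NonZero j}} → d ℕ.* d ℕ.^ ℕ.pred j ≡ d ℕ.^ j
    split {suc j} = refl
    small : k ℕ.* d ℕ.^ ℕ.pred k ℕ.< n
    small = ℕ.*-cancelˡ-< (2 ℕ.* L) _ _ (begin-strict
      2 ℕ.* L ℕ.* (k ℕ.* d ℕ.^ ℕ.pred k)    ≡⟨ ℕ.*-assoc (2 ℕ.* L) k _ ⟨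
      2 ℕ.* L ℕ.* k ℕ.* d ℕ.^ ℕ.pred k      <⟨ ℕ.*-monoˡ-< (d ℕ.^ ℕ.pred k) {{ℕ.m^n≢0 d (ℕ.pred k) {{d≢0}}}} 2Lk<d ⟩
      d ℕ.* d ℕ.^ ℕ.pred k                  ≡⟨ split {k} {{k≢0}} ⟩
      d ℕ.^ k                               ≤⟨ half-power d A k {{d≢0}} 2kA≤d ⟩
      2 ℕ.* x ℕ.^ k                         ≤⟨ ℕ.*-monoʳ-≤ 2 (ℕ.≤-trans (ℕ.m≤n*m (x ℕ.^ k) w) large) ⟩
      2 ℕ.* (L ℕ.* n)                       ≡⟨ ℕ.*-assoc 2 L n ⟨
      2 ℕ.* L ℕ.* n                         ∎)
    -- Here `2 ≤ k` enters: `d` is at most `d^(k-1)`, so the bound `small` also yields `d < n`.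
    linear : ∀ {j} → 2 ℕ.≤ j → d ℕ.≤ d ℕ.^ ℕ.pred j
    linear {suc (suc j)} _ = ℕ.m≤m*n d (d ℕ.^ j) {{ℕ.m^n≢0 d j {{d≢0}}}}
    linear {suc zero} (ℕ.s≤s ())
    d<n : d ℕ.< n
    d<n = ℕ.≤-<-trans (ℕ.≤-trans (linear 2≤k) (ℕ.m≤n*m (d ℕ.^ ℕ.pred k) k {{k≢0}})) small

-- The conclusion is `w / L - 1 / E ≤ m / d^k` without denominators. The Bernoulli loss, scaled by
-- `E w`, is absorbed by one factor `d`.
power-bound : ∀ k w A L E d m .{{_ : NonZero d}} .{{_ : NonZero L}} →
  E ℕ.* (w ℕ.* (k ℕ.* A)) ℕ.≤ d → w ℕ.* (d ℕ.∸ A) ℕ.^ k ℕ.≤ L ℕ.* m →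
  E ℕ.* (w ℕ.* d ℕ.^ k) ℕ.≤ L ℕ.* (E ℕ.* m ℕ.+ d ℕ.^ k)
power-bound k w A L E d m small large = ℕ.*-cancelˡ-≤ d (begin
    d ℕ.* (E ℕ.* (w ℕ.* D))                                       ≡⟨ pull d E w D ⟩
    E ℕ.* (w ℕ.* (d ℕ.* D))                                       ≤⟨ ℕ.*-monoʳ-≤ E (ℕ.*-monoʳ-≤ w (power-loss d A k)) ⟩
    E ℕ.* (w ℕ.* (d ℕ.* X ℕ.+ k ℕ.* A ℕ.* D))                     ≡⟨ expand E w d X (k ℕ.* A) D ⟩
    d ℕ.* (E ℕ.* (w ℕ.* X)) ℕ.+ E ℕ.* (w ℕ.* (k ℕ.* A)) ℕ.* D     ≤⟨ ℕ.+-mono-≤ (ℕ.*-monoʳ-≤ d (ℕ.*-monoʳ-≤ E large)) (ℕ.*-monoˡ-≤ D small) ⟩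
    d ℕ.* (E ℕ.* (L ℕ.* m)) ℕ.+ d ℕ.* D                           ≤⟨ ℕ.+-monoʳ-≤ _ (ℕ.*-monoʳ-≤ d (ℕ.m≤n*m D L)) ⟩
    d ℕ.* (E ℕ.* (L ℕ.* m)) ℕ.+ d ℕ.* (L ℕ.* D)                   ≡⟨ collect d E L m D ⟩
    d ℕ.* (L ℕ.* (E ℕ.* m ℕ.+ D))                                 ∎)
  where
  open ℕ.≤-Reasoning
  D = d ℕ.^ k
  X = (d ℕ.∸ A) ℕ.^ k
  pull : ∀ d E w D → d ℕ.* (E ℕ.* (w ℕ.* D)) ≡ E ℕ.* (w ℕ.* (d ℕ.* D))
  pull = ℕ.solve-∀
  expand : ∀ E w d X b D → E ℕ.* (w ℕ.* (d ℕ.* X ℕ.+ b ℕ.* D)) ≡ d ℕ.* (E ℕ.* (w ℕ.* X)) ℕ.+ E ℕ.* (w ℕ.* b) ℕ.* D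
  expand = ℕ.solve-∀
  collect : ∀ d E L m D → d ℕ.* (E ℕ.* (L ℕ.* m)) ℕ.+ d ℕ.* (L ℕ.* D) ≡ d ℕ.* (L ℕ.* (E ℕ.* m ℕ.+ D))
  collect = ℕ.solve-∀

-- From natural numbers to rationals.

+-cancelʳ-≤ : ∀ k {i j} → i + k ℤ.≤ j + k → i ℤ.≤ j
+-cancelʳ-≤ k {i} {j} i+k≤j+k = subst₂ ℤ._≤_ (cancel i k) (cancel j k) (ℤ.+-monoˡ-≤ (- k) i+k≤j+k)
  where
  cancel : ∀ i k → i + k + - k ≡ i
  cancel = solve-∀

-- The conclusion is what `(p/Q - suc e / E) D ≤ m` unfolds to for unnormalised fractions.
-- Multiplied by `L`, with `p L = w Q` substituted, it follows from `Q` times the hypothesis and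
-- `1 ≤ suc e`.
cross-multiplied : ∀ p Q E e w L D m .{{_ : NonZero L}} → p * + L ≡ + w * + Q →
  E ℕ.* (w ℕ.* D) ℕ.≤ L ℕ.* (E ℕ.* m ℕ.+ D) →
  (p * + E + - + suc e * + Q) * + D * 1ℤ ℤ.≤ + m * + (Q ℕ.* E ℕ.* 1)
cross-multiplied p Q E e w L@(suc _) D m pL≡wQ bound =
  ℤ.*-cancelʳ-≤-pos _ _ (+ L) (+-cancelʳ-≤ (+ suc e * (+ Q * (+ D * + L))) (begin
    (p * + E + - + suc e * + Q) * + D * 1ℤ * + L + + suc e * (+ Q * (+ D * + L))
      ≡⟨ cancel p (+ E) (+ suc e) (+ Q) (+ D) (+ L) ⟩
    p * + L * (+ E * + D)                       ≡⟨ cong (_* (+ E * + D)) pL≡wQ ⟩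
    + w * + Q * (+ E * + D)                     ≡⟨ rotate (+ w) (+ Q) (+ E) (+ D) ⟩
    + Q * (+ E * (+ w * + D))                   ≡⟨ pos-*₄ Q E w D ⟨
    + (Q ℕ.* (E ℕ.* (w ℕ.* D)))                 ≤⟨ ℤ.+≤+ nat ⟩
    + (m ℕ.* (Q ℕ.* E ℕ.* 1) ℕ.* L ℕ.+ suc e ℕ.* (Q ℕ.* (D ℕ.* L)))
      ≡⟨ cong₂ _+_ (trans (ℤ.pos-* (m ℕ.* (Q ℕ.* E ℕ.* 1)) L) (cong (_* + L) (ℤ.pos-* m (Q ℕ.* E ℕ.* 1))))
                   (pos-*₄ (suc e) Q D L) ⟩
    + m * + (Q ℕ.* E ℕ.* 1) * + L + + suc e * (+ Q * (+ D * + L)) ∎))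
  where
  open ℤ.≤-Reasoning
  pos-*₄ : ∀ a b c d → + (a ℕ.* (b ℕ.* (c ℕ.* d))) ≡ + a * (+ b * (+ c * + d))
  pos-*₄ a b c d = trans (ℤ.pos-* a _) (cong (λ x → + a * x)
    (trans (ℤ.pos-* b _) (cong (λ x → + b * x) (ℤ.pos-* c d))))
  cancel : ∀ p E e Q D L → (p * E + - e * Q) * D * 1ℤ * L + e * (Q * (D * L)) ≡ p * L * (E * D)
  cancel = solve-∀
  rotate : ∀ w Q E D → w * Q * (E * D) ≡ Q * (E * (w * D))
  rotate = solve-∀
  expand : ∀ Q L E m D → Q ℕ.* (L ℕ.* (E ℕ.* m ℕ.+ D)) ≡ m ℕ.* (Q ℕ.* E ℕ.* 1) ℕ.* L ℕ.+ Q ℕ.* (D ℕ.* L)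
  expand = ℕ.solve-∀
  nat : Q ℕ.* (E ℕ.* (w ℕ.* D)) ℕ.≤ m ℕ.* (Q ℕ.* E ℕ.* 1) ℕ.* L ℕ.+ suc e ℕ.* (Q ℕ.* (D ℕ.* L))
  nat = ℕ.≤-trans (ℕ.*-monoʳ-≤ Q bound) (ℕ.≤-trans (ℕ.≤-reflexive (expand Q L E m D))
    (ℕ.+-monoʳ-≤ (m ℕ.* (Q ℕ.* E ℕ.* 1) ℕ.* L) (ℕ.m≤n*m _ (suc e))))

toℚᵘ-fromℕ : ∀ m → toℚᵘ (fromℕ m) ℚᵘ.≃ mkℚᵘ (+ m) 0
toℚᵘ-fromℕ m = ℚ.toℚᵘ-fromℚᵘ (mkℚᵘ (+ m) 0)

toℚᵘ-deficit : ∀ c ε m → toℚᵘ ((c ℚ.- ε) ℚ.* fromℕ m) ℚᵘ.≃ (toℚᵘ c ℚᵘ.- toℚᵘ ε) ℚᵘ.* mkℚᵘ (+ m) 0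
toℚᵘ-deficit c ε m = ℚᵘ.≃-trans (ℚ.toℚᵘ-homo-* (c ℚ.- ε) (fromℕ m)) (ℚᵘ.*-cong
  (ℚᵘ.≃-trans (ℚ.toℚᵘ-homo-+ c (ℚ.- ε)) (ℚᵘ.+-congʳ (toℚᵘ c) (ℚ.toℚᵘ-homo‿- ε)))
  (toℚᵘ-fromℕ m))

-- A positive `ε` is at least 1 over its denominator, so precision `1 / E` suffices.
rational-bound : ∀ c ε w L D m .{{_ : NonZero L}} → 0ℚ ℚ.< ε → ↥ c * + L ≡ + w * ↧ c →
  ℚ.↧ₙ ε ℕ.* (w ℕ.* D) ℕ.≤ L ℕ.* (ℚ.↧ₙ ε ℕ.* m ℕ.+ D) → (c ℚ.- ε) ℚ.* fromℕ D ℚ.≤ fromℕ m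
rational-bound c (mkℚ (+ 0)    _ _) w L D m (ℚ.*<* (ℤ.+<+ ()))
rational-bound c (mkℚ -[1+ _ ] _ _) w L D m (ℚ.*<* ())
rational-bound c@(mkℚ p Q-1 _) ε@(mkℚ +[1+ e ] E-1 _) w L D m _ c≡ bound =
  ℚ.toℚᵘ-cancel-≤ (ℚᵘ.≤-respˡ-≃ (ℚᵘ.≃-sym (toℚᵘ-deficit c ε D)) (ℚᵘ.≤-respʳ-≃ (ℚᵘ.≃-sym (toℚᵘ-fromℕ m))
    (*≤* (cross-multiplied p (suc Q-1) (suc E-1) e w L D m c≡ bound))))

-- The maximality in `IsDCC` carries the order of the constructed graph over to `m`. The equation
-- says `c = w / (k+2)^k`, in a form that `refl` can check for concrete numbers.
liminf-bound : ∀ k w .{{_ : NonZero w}} β c → 2 ℕ.≤ k → OmitSumsCover k w β →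
  ↥ c * + (suc (suc k) ℕ.^ k) ≡ + w * ↧ c → LiminfGE k c
liminf-bound k w β c 2≤k sums-cover c≡ ε 0<ε = threshold , λ d d≥ m isDCC →
    let d≥A , d≥rest   = split A d≥
        d≥a , d≥rest′  = split a d≥rest
        d≥b , d≥c      = split b d≥rest′
        n , large , G  = proj₂ circulants d d≥A d≥a d≥b
    in rational-bound c ε w L (d ℕ.^ k) m 0<ε c≡
         (power-bound k w A L E d m {{ℕ.>-nonZero (ℕ.≤-trans (ℕ.s≤s ℕ.z≤n) d≥b)}} d≥c
           (ℕ.≤-trans large (ℕ.*-monoʳ-≤ L (proj₂ isDCC n G))))
  where
  L E A a b threshold : ℕ
  L = suc (suc k) ℕ.^ k
  E = ℚ.↧ₙ ε
  circulants = large-circulants k w β 2≤k sums-cover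
  A = proj₁ circulants
  a = 2 ℕ.* (k ℕ.* A)
  b = suc (2 ℕ.* L ℕ.* k)
  -- A sum in place of a maximum of the four lower bounds on `d`.
  threshold = A ℕ.+ (a ℕ.+ (b ℕ.+ E ℕ.* (w ℕ.* (k ℕ.* A))))
  instance
    L≢0 : NonZero L
    L≢0 = ℕ.m^n≢0 (suc (suc k)) k
  split : ∀ x {y d} → x ℕ.+ y ℕ.≤ d → x ℕ.≤ d × y ℕ.≤ d
  split x {y} x+y≤d = ℕ.≤-trans (ℕ.m≤m+n x y) x+y≤d , ℕ.≤-trans (ℕ.m≤n+m y x) x+y≤d

-- Deciding the finite conditions, and the eight cases.

omitSumsCover? : ∀ k w .{{_ : NonZero w}} β → Dec (OmitSumsCover k w β)
omitSumsCover? k w β = Fin.all? λ c → Fin.any? λ p → Fin.any? λ r → sum (λ i → β (omit p r i)) ℕ.% w ℕ.≟ toℕ c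

-- Both `True` arguments are settled by evaluation. `c` is `w / (k+2)^k` in lowest terms, for
-- example 24 / 8^6 = 3 / 32768.
part : ∀ k₀ w .{{_ : NonZero w}} c r → let k = suc (suc k₀) in (β : Vec ℕ (suc (suc k))) →
  ↥ c * + (suc (suc k) ℕ.^ k) ≡ + w * ↧ c →
  {True (omitSumsCover? k w (lookup β))} → {True (powℚ (r ℚ.* (+ 1 / k)) k ℚ.<? c)} →
  Part k c r
-- With `δ = c - (r/k)^k` the bound required for `r` is the one for `c` again.
part k₀ w c r β c≡ {cover} {r<} = liminf , c ℚ.- x , 0<c-x , subst (LiminfGE k) (sym x+c-x) liminf
  where
  k = suc (suc k₀)
  x = powℚ (r ℚ.* (+ 1 / k)) k
  liminf : LiminfGE k c
  liminf = liminf-bound k w (lookup β) c (ℕ.s≤s (ℕ.s≤s ℕ.z≤n)) (toWitness cover) c≡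
  0<c-x : 0ℚ ℚ.< c ℚ.- x
  0<c-x = subst (ℚ._< c ℚ.- x) (ℚ.+-inverseʳ x) (ℚ.+-monoˡ-< (ℚ.- x) (toWitness r<))
  x+c-x : x ℚ.+ (c ℚ.- x) ≡ c
  x+c-x = begin
    x ℚ.+ (c ℚ.- x)       ≡⟨ ℚ.+-comm x (c ℚ.- x) ⟩
    c ℚ.- x ℚ.+ x         ≡⟨ ℚ.+-assoc c (ℚ.- x) x ⟩
    c ℚ.+ (ℚ.- x ℚ.+ x)   ≡⟨ cong (c ℚ.+_) (ℚ.+-inverseˡ x) ⟩
    c ℚ.+ 0ℚ              ≡⟨ ℚ.+-identityʳ c ⟩
    c                     ∎
    where open ≡-Reasoning

theorem10 : Part 2 (+ 3 / 8) (+ 122474 / 100000)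
    × Part 3 (+ 9 / 125) (+ 124805 / 100000)
    × Part 4 (+ 13 / 1296) (+ 126588 / 100000)
    × Part 5 (+ 17 / 16807) (+ 125881 / 100000)
    × Part 6 (+ 3 / 32768) (+ 127378 / 100000)
    × Part 7 (+ 10 / 1594323) (+ 126436 / 100000)
    × Part 8 (+ 9 / 25000000) (+ 125206 / 100000)
    × Part 9 (+ 42 / 2357947691) (+ 123939 / 100000)
-- The offset sets, all containing 0, come from an exhaustive search.
theorem10 =
    part 0 6  (+ 3 / 8)           (+ 122474 / 100000) (0 ∷ 1 ∷ 2 ∷ 4 ∷ []) refl
  , part 1 9  (+ 9 / 125)         (+ 124805 / 100000) (0 ∷ 1 ∷ 2 ∷ 3 ∷ 6 ∷ []) refl
  , part 2 13 (+ 13 / 1296)       (+ 126588 / 100000) (0 ∷ 1 ∷ 2 ∷ 3 ∷ 6 ∷ 10 ∷ []) refl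
  , part 3 17 (+ 17 / 16807)      (+ 125881 / 100000) (0 ∷ 1 ∷ 2 ∷ 3 ∷ 4 ∷ 8 ∷ 13 ∷ []) refl
  , part 4 24 (+ 3 / 32768)       (+ 127378 / 100000) (0 ∷ 1 ∷ 2 ∷ 4 ∷ 8 ∷ 13 ∷ 18 ∷ 22 ∷ []) refl
  , part 5 30 (+ 10 / 1594323)    (+ 126436 / 100000) (0 ∷ 1 ∷ 2 ∷ 4 ∷ 10 ∷ 15 ∷ 17 ∷ 22 ∷ 28 ∷ []) refl
  , part 6 36 (+ 9 / 25000000)    (+ 125206 / 100000) (0 ∷ 1 ∷ 2 ∷ 3 ∷ 6 ∷ 12 ∷ 19 ∷ 20 ∷ 27 ∷ 33 ∷ []) refl
  , part 7 42 (+ 42 / 2357947691) (+ 123939 / 100000) (0 ∷ 1 ∷ 2 ∷ 3 ∷ 4 ∷ 9 ∷ 16 ∷ 20 ∷ 26 ∷ 30 ∷ 37 ∷ []) refl
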